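{- Let $k\ge2$, $m\ge0$, $1\le s\le k$, and $N=mk+s$. For vincular patterns of length three in which exactly the first two letters are required to be adjacent, the numbers of avoiding permutations in $\mathcal{D}_{mk+s,k}$ are as follows. (1) $|\mathcal{D}_{N,k}(\underline{12}3)|=0$ if $k\ge3$ and $N\ge3$; and for $k=2$, $$|\mathcal{D}_{2m+1,2}(\underline{12}3)|=2^m m!,\qquad |\mathcal{D}_{2m+2,2}(\underline{12}3)|=\prod_{j=1}^{m}(2j+1).$$ (2) $|\mathcal{D}_{N,k}(\underline{13}2)|=\frac{s}{mk+s}\binom{mk+s}{m}$. (3) $|\mathcal{D}_{N,k}(\underline{21}3)|=\prod_{j=1}^{m}\binom{s+jk-1}{k-1}$. (4) $|\mathcal{D}_{N,k}(\underline{23}1)|=\prod_{j=0}^{m-1}(s+jk)$. (5) $|\mathcal{D}_{N,k}(\underline{31}2)|=\frac{1}{(k-1)(m+1)+1}\binom{k(m+1)}{m+1}$. (6) $|\mathcal{D}_{N,k}(\underline{32}1)|=\operatorname{LE}(P^{321}_{m,s,k})$, where $P^{321}_{m,s,k}$ is the poset obtained from the block poset $B_{m,s,k}$ by adding, for each $1\le i\le m$, the relations $x_{i+1,1}<x_{j,a}$ for every position $(j,a)$ lying strictly to the right of $x_{i+1,1}$.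
   Context: For $\pi=\pi_1\cdots\pi_N\in S_N$ let $\operatorname{Des}(\pi)=\{i\in[N-1]:\pi_i>\pi_{i+1}\}$. For $k\ge2$, $N\ge1$, let $\mathcal{D}_{N,k}=\{\pi\in S_N:\operatorname{Des}(\pi)=\{k,2k,\ldots,k\lfloor (N-1)/k\rfloor\}\}$. For $abc\in S_3$, $\pi$ contains the vincular pattern $\underline{ab}c$ if there are positions $i<i+1<j$ such that $\pi_i\pi_{i+1}\pi_j$ has the same relative order as $abc$; otherwise it avoids it. $\mathcal{D}_{N,k}(p)$ is the set of elements of $\mathcal{D}_{N,k}$ avoiding $p$. Empty products equal $1$. Write $N=mk+s$ with $1\le s\le k$, and split the positions $1,\ldots,N$ from left to right into $m$ blocks of length $k$ followed by a last block of length $s$; $x_{i,a}$ is the $a$-th position of the $i$-th block ($1\le a\le k$ for $i\le m$, $1\le a\le s$ for $i=m+1$). The block poset $B_{m,s,k}$ on the elements $x_{i,a}$ is generated by $x_{i,a}<x_{i,a+1}$ inside each block and $x_{i+1,1}<x_{i,k}$ for $1\le i\le m$. "Adding relations" to a poset means taking the transitive closure. "Left/right/earlier" refer to the order of positions $1,\ldots,N$. $\operatorname{LE}(P)$ is the number of linear extensions of a finite poset $P$. -}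

module Defs where

open import Data.Empty using (⊥-elim)
open import Data.Fin.Base as Fin using (Fin; toℕ)
open import Data.Fin.Properties as Fin using (toℕ<n)
open import Data.List.Base using (List; [_]; length; filter; map; upTo; allFin; cartesianProductWith)
open import Data.Nat.Base
open import Data.Nat.ListAction using (product)
open import Data.Nat.DivMod using (_/_; _%_; m≡m%n+[m/n]*n)
open import Data.Nat.Induction using (<-wellFounded)
open import Data.Nat.Properties
open import Data.Product.Base using (∃; ∃₂; _×_; _,_; proj₁; proj₂)
open import Data.Sum.Base using (inj₁; inj₂)
open import Data.Vec.Base as Vec using (Vec; lookup)
open import Data.Vec.Relation.Unary.AllPairs using (allPairs?)
open import Data.Vec.Relation.Unary.Unique.Propositional using (Unique)
open import Function.Base using (_∘_)
open import Function.Bundles using (_⇔_; mk⇔; Equivalence)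
open import Induction.WellFounded using (Acc; acc)
open import Level using (0ℓ)
open import Relation.Binary.Core using (Rel)
open import Relation.Binary.Definitions as Binary using ()
open import Relation.Binary.Construct.Closure.Transitive as Trans using (TransClosure; _∷_; _++_)
open import Relation.Binary.Construct.Union using (_∪_)
open import Relation.Binary.PropositionalEquality using (_≡_; refl; sym; cong; cong₂; subst; isEquivalence)
open import Relation.Binary.Structures using (IsDecStrictPartialOrder)
open import Relation.Nullary.Decidable as Dec using (Dec; yes; no; ¬?; _×-dec_; _⊎-dec_; _→-dec_)
open import Relation.Nullary.Negation using (¬_)
open import Relation.Unary using (Pred; Decidable; _≐_)

------------------------------------------------------------------------
-- Products and counting

-- ∏_{j=0}^{m-1} f j
∏[0≤j<_] : ℕ → (ℕ → ℕ) → ℕ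
∏[0≤j< m ] f = product (map f (upTo m))

-- ∏_{j=1}^{m} f j
∏[1≤j≤_] : ℕ → (ℕ → ℕ) → ℕ
∏[1≤j≤ m ] f = ∏[0≤j< m ] (f ∘ suc)

-- Every word of length ℓ over Fin n, each exactly once.
words : ∀ n ℓ → List (Vec (Fin n) ℓ)
words n zero    = [ Vec.[] ]
words n (suc ℓ) = cartesianProductWith Vec._∷_ (allFin n) (words n ℓ)

count : ∀ {n ℓ} {P : Pred (Vec (Fin n) ℓ) 0ℓ} → Decidable P → ℕ
count {n} {ℓ} P? = length (filter P? (words n ℓ))

------------------------------------------------------------------------
-- Permutations in one-line notation

-- A word π₁⋯πₙ of length n over an n-letter alphabet is a permutation
-- precisely when no letter is repeated.  The index p : Fin n stands for
-- the position toℕ p + 1, and likewise for the letters.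
IsPermutation : ∀ {n} → Pred (Vec (Fin n) n) 0ℓ
IsPermutation = Unique

isPermutation? : ∀ {n} → Decidable (IsPermutation {n})
isPermutation? = allPairs? λ x y → ¬? (x Fin.≟ y)

-- Des π, with the positions counted from 1: p and q below are the i-th and
-- (i+1)-st positions.
Des : ∀ {n} → Vec (Fin n) n → Pred ℕ 0ℓ
Des {n} π i = ∃₂ λ (p q : Fin n) →
  suc (toℕ p) ≡ i × toℕ q ≡ i × lookup π q Fin.< lookup π p

-- {k, 2k, …, k⌊(N-1)/k⌋}
Multiples : (N k : ℕ) .{{_ : NonZero k}} → Pred ℕ 0ℓ
Multiples N k i = ∃ λ j → 1 ≤ j × j ≤ (N ∸ 1) / k × i ≡ k * j

𝒟 : (N k : ℕ) .{{_ : NonTrivial k}} → Pred (Vec (Fin N) N) 0ℓ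
𝒟 N k π = IsPermutation π × Des π ≐ Multiples N k
  where instance _ = nonTrivial⇒nonZero k

SameRelativeOrder : ∀ {n} → Vec ℕ n → Vec ℕ n → Set
SameRelativeOrder u v = ∀ i j → lookup u i < lookup u j ⇔ lookup v i < lookup v j

-- Occurrence of the vincular pattern abc, a and b adjacent; abc is given by
-- its letters in one-line notation, e.g. 1 ∷ 3 ∷ 2 ∷ [].
Contains : ∀ {n} → Vec ℕ 3 → Pred (Vec (Fin n) n) 0ℓ
Contains {n} abc π = ∃₂ λ (p q : Fin n) → ∃ λ (r : Fin n) →
  toℕ q ≡ suc (toℕ p) × q Fin.< r ×
  SameRelativeOrder (Vec.map (toℕ ∘ lookup π) (p Vec.∷ q Vec.∷ r Vec.∷ Vec.[])) abc

𝒟Avoiding : (N k : ℕ) .{{_ : NonTrivial k}} → Vec ℕ 3 → Pred (Vec (Fin N) N) 0ℓ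
𝒟Avoiding N k abc π = 𝒟 N k π × ¬ Contains abc π

private
  Des? : ∀ {n} (π : Vec (Fin n) n) → Decidable (Des π)
  Des? π i = Fin.any? λ p → Fin.any? λ q →
    suc (toℕ p) ≟ i ×-dec toℕ q ≟ i ×-dec lookup π q Fin.<? lookup π p

  Multiples? : ∀ N k .{{_ : NonZero k}} → Decidable (Multiples N k)
  Multiples? N k i = Dec.map′
    (λ (j , j<b , 1≤j , e) → j , 1≤j , ≤-pred j<b , e)
    (λ (j , 1≤j , j≤b , e) → j , s≤s j≤b , 1≤j , e)
    (anyUpTo? (λ j → 1 ≤? j ×-dec i ≟ k * j) (suc ((N ∸ 1) / k)))

  Des≐Multiples? : ∀ N k .{{_ : NonZero k}} (π : Vec (Fin N) N) → Dec (Des π ≐ Multiples N k)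
  Des≐Multiples? N k π =
    Dec.map′
      (λ f {i} → λ { (p , q , e , refl , d) → f q (p , q , e , refl , d) })
      (λ f q → f {toℕ q})
      (Fin.all? λ q → Des? π (toℕ q) →-dec Multiples? N k (toℕ q))
    ×-dec
    Dec.map′
      (λ f {i} → λ { (j , 1≤j , j≤b , refl) → f (s≤s j≤b) 1≤j })
      (λ f {j} j<b 1≤j → f (j , 1≤j , ≤-pred j<b , refl))
      (allUpTo? (λ j → 1 ≤? j →-dec Des? π (k * j)) (suc ((N ∸ 1) / k)))

  _⇔-dec_ : {A B : Set} → Dec A → Dec B → Dec (A ⇔ B)
  a? ⇔-dec b? = Dec.map′ (λ (f , g) → mk⇔ f g)
                         (λ e → Equivalence.to e , Equivalence.from e)
                         ((a? →-dec b?) ×-dec (b? →-dec a?))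

𝒟? : ∀ N k .{{_ : NonTrivial k}} → Decidable (𝒟 N k)
𝒟? N k π = isPermutation? π ×-dec Des≐Multiples? N k π
  where instance _ = nonTrivial⇒nonZero k

contains? : ∀ {n} (abc : Vec ℕ 3) → Decidable (Contains {n} abc)
contains? abc π = Fin.any? λ p → Fin.any? λ q → Fin.any? λ r →
  toℕ q ≟ suc (toℕ p) ×-dec q Fin.<? r ×-dec
  (Fin.all? λ i → Fin.all? λ j → (_ <? _) ⇔-dec (_ <? _))

𝒟Avoiding? : ∀ N k .{{_ : NonTrivial k}} abc → Decidable (𝒟Avoiding N k abc)
𝒟Avoiding? N k abc π = 𝒟? N k π ×-dec ¬? (contains? abc π)

∣𝒟_,_⟨_⟩∣ : (N k : ℕ) .{{_ : NonTrivial k}} → Vec ℕ 3 → ℕ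
∣𝒟 N , k ⟨ abc ⟩∣ = count (𝒟Avoiding? N k abc)

------------------------------------------------------------------------
-- Linear extensions of a finite poset

-- f labels the element x with its place lookup f x in the linear order.
IsLinearExtension : ∀ {n} → Rel (Fin n) 0ℓ → Pred (Vec (Fin n) n) 0ℓ
IsLinearExtension _≺_ f = Unique f × (∀ x y → x ≺ y → lookup f x Fin.< lookup f y)

isLinearExtension? : ∀ {n} {_≺_ : Rel (Fin n) 0ℓ} → Binary.Decidable _≺_ →
                     Decidable (IsLinearExtension _≺_)
isLinearExtension? _≺?_ f = isPermutation? f ×-dec
  (Fin.all? λ x → Fin.all? λ y → x ≺? y →-dec lookup f x Fin.<? lookup f y)

LE : ∀ {n} {_≺_ : Rel (Fin n) 0ℓ} → IsDecStrictPartialOrder _≡_ _≺_ → ℕ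
LE po = count (isLinearExtension? (IsDecStrictPartialOrder._<?_ po))

------------------------------------------------------------------------
-- The block poset and the poset P³²¹

Position : (m s k : ℕ) → Set
Position m s k = Fin (m * k + s)

module _ (m s k : ℕ) .{{_ : NonTrivial k}} where

  private instance
    k≢0 : NonZero k
    k≢0 = nonTrivial⇒nonZero k

  -- The position x_{i,a} has block i - 1 and offset a - 1.
  block offset : Position m s k → ℕ
  block  p = toℕ p / k
  offset p = toℕ p % k

  -- within : x_{i,a} < x_{i,a+1};  across : x_{i+1,1} < x_{i,k}
  data BlockGenerator : Rel (Position m s k) 0ℓ where
    within : ∀ {p q} → block p ≡ block q → offset q ≡ suc (offset p) → BlockGenerator p q
    across : ∀ {p q} → block p ≡ suc (block q) → offset p ≡ 0 → offset q ≡ k ∸ 1 →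
             BlockGenerator p q

  Block : Rel (Position m s k) 0ℓ
  Block = TransClosure BlockGenerator

  -- x_{i+1,1} < y for i ≥ 1 and every y to the right of x_{i+1,1}
  FirstBelowRight : Rel (Position m s k) 0ℓ
  FirstBelowRight p q = 1 ≤ block p × offset p ≡ 0 × p Fin.< q

  P³²¹ : Rel (Position m s k) 0ℓ
  P³²¹ = TransClosure (Block ∪ FirstBelowRight)

-- P³²¹ is acyclic and decidable: placing the first positions of all blocks
-- (from left to right) before all the other positions (from left to right)
-- is strictly increasing along every generating relation.
private
  module Ranked {n} {R : Rel (Fin n) 0ℓ} (R? : Binary.Decidable R)
                (rank : Fin n → ℕ) (mono : ∀ {x y} → R x y → rank x < rank y) where

    mono⁺ : ∀ {x y} → TransClosure R x y → rank x < rank y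
    mono⁺ Trans.[ r ] = mono r
    mono⁺ (r ∷ rs)    = <-trans (mono r) (mono⁺ rs)

    closure? : Binary.Decidable (TransClosure R)
    closure? x y = go x (<-wellFounded (rank y ∸ rank x))
      where
      go : ∀ x → Acc _<_ (rank y ∸ rank x) → Dec (TransClosure R x y)
      go x (acc rec) = Dec.map′
        (λ { (inj₁ r) → Trans.[ r ] ; (inj₂ (z , r , rs)) → r ∷ rs })
        (λ { Trans.[ r ] → inj₁ r ; (r ∷ rs) → inj₂ (_ , r , rs) })
        (R? x y ⊎-dec Fin.any? step)
        where
        step : ∀ z → Dec (R x z × TransClosure R z y)
        step z with R? x z | rank z ≤? rank y
        ... | no ¬r | _       = no (¬r ∘ proj₁)
        ... | yes r | no z≰y  = no λ (_ , rs) → z≰y (<⇒≤ (mono⁺ rs))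
        ... | yes r | yes z≤y = Dec.map′ (r ,_) proj₂ (go z (rec (∸-monoʳ-< (mono r) z≤y)))

    isDecStrictPartialOrder : IsDecStrictPartialOrder _≡_ (TransClosure R)
    isDecStrictPartialOrder = record
      { isStrictPartialOrder = record
        { isEquivalence = isEquivalence
        ; irrefl        = λ { refl rs → <-irrefl refl (mono⁺ rs) }
        ; trans         = _++_
        ; <-resp-≈      = (λ { refl rs → rs }) , (λ { refl rs → rs })
        }
      ; _≟_  = Fin._≟_
      ; _<?_ = closure?
      }

  module _ (m s k : ℕ) .{{_ : NonTrivial k}} where

    private
      N = m * k + s
      instance
        k≢0 : NonZero k
        k≢0 = nonTrivial⇒nonZero k

    delay : ℕ → ℕ
    delay zero    = 0
    delay (suc _) = N

    rank : Position m s k → ℕ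
    rank p = delay (offset m s k p) + toℕ p

    delayed : ∀ {p q : Position m s k} → toℕ p < toℕ q → NonZero (offset m s k q) → rank p < rank q
    delayed {p} {q} p<q o≢0 with offset m s k q | offset m s k p
    ... | suc _ | zero  = <-≤-trans p<q (m≤n+m _ N)
    ... | suc _ | suc _ = +-monoʳ-< N p<q

    firstBelowRight-mono : ∀ {p q} → FirstBelowRight m s k p q → rank p < rank q
    firstBelowRight-mono {p} {q} (_ , o≡0 , p<q) rewrite o≡0 = <-≤-trans p<q (m≤n+m _ _)

    blockGenerator-mono : ∀ {p q} → BlockGenerator m s k p q → rank p < rank q
    blockGenerator-mono {p} {q} (within b≡ o≡) = delayed p<q (subst NonZero (sym o≡) _)
      where
      p<q : toℕ p < toℕ q
      p<q = begin-strict
        toℕ p                                       ≡⟨ m≡m%n+[m/n]*n (toℕ p) k ⟩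
        offset m s k p + block m s k p * k          <⟨ n<1+n _ ⟩
        suc (offset m s k p) + block m s k p * k    ≡⟨ cong₂ _+_ o≡ (cong (_* k) (sym b≡)) ⟨
        offset m s k q + block m s k q * k          ≡⟨ m≡m%n+[m/n]*n (toℕ q) k ⟨
        toℕ q                                       ∎
        where open ≤-Reasoning
    blockGenerator-mono {p} {q} (across _ op≡0 oq≡) with offset m s k q | m<n⇒0<n∸m (nonTrivial⇒n>1 k)
    ... | zero  | 0<k∸1 = ⊥-elim (<-irrefl oq≡ 0<k∸1)
    ... | suc _ | _ rewrite op≡0 = <-≤-trans (toℕ<n p) (m≤m+n N _)

    blockGenerator? : Binary.Decidable (BlockGenerator m s k)
    blockGenerator? p q = Dec.map′
      (λ { (inj₁ (b , o)) → within b o ; (inj₂ (b , o , o′)) → across b o o′ })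
      (λ { (within b o) → inj₁ (b , o) ; (across b o o′) → inj₂ (b , o , o′) })
      ((block m s k p ≟ block m s k q ×-dec offset m s k q ≟ suc (offset m s k p))
       ⊎-dec
       (block m s k p ≟ suc (block m s k q) ×-dec offset m s k p ≟ 0 ×-dec offset m s k q ≟ k ∸ 1))

    module BlockRanked = Ranked blockGenerator? rank blockGenerator-mono

    generator? : Binary.Decidable (Block m s k ∪ FirstBelowRight m s k)
    generator? p q = BlockRanked.closure? p q ⊎-dec
      (1 ≤? block m s k p ×-dec offset m s k p ≟ 0 ×-dec p Fin.<? q)

    generator-mono : ∀ {p q} → (Block m s k ∪ FirstBelowRight m s k) p q → rank p < rank q
    generator-mono (inj₁ r) = BlockRanked.mono⁺ r
    generator-mono (inj₂ r) = firstBelowRight-mono r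

    module P³²¹Ranked = Ranked generator? rank generator-mono

P³²¹-poset : ∀ m s k .{{_ : NonTrivial k}} → IsDecStrictPartialOrder _≡_ (P³²¹ m s k)
P³²¹-poset m s k = P³²¹Ranked.isDecStrictPartialOrder m s k

instance
  m+n-nonZero : ∀ {m n} .{{_ : NonZero n}} → NonZero (m + n)
  m+n-nonZero {m} {suc n} = subst NonZero (sym (+-suc m n)) _

{-# OPTIONS --safe #-}

-- Standardising the suffixes of a permutation, one gets a permutation of length
-- L + 1 from one of length L by prepending a letter a and raising the letters
-- ≥ a.  All letters other than the first two occur later in the word, so whether
-- the first two letters start an occurrence of the pattern depends only on a, L
-- and the old first letter b.  The counts by first letter therefore satisfy a
-- linear recursion:
--   123, 213, 231: from block to block the total number is just multiplied;
--   312: the counts by first letter are Rothe's numbers x/(x+nk) C(x+nk, n);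
--   132: the transposed recursion is solved by the same numbers.
-- For 321 the avoidance condition is literally that of a linear extension.
module Submission where

open import Defs
import Algebra.Properties.CommutativeSemigroup as CommutativeSemigroup
import Algebra.Properties.Semiring.Sum as Sum
open import Data.Bool.Base using (Bool; true; false; T; not; _∧_; if_then_else_)
open import Data.Bool.Properties using (T-∧)
open import Data.Fin.Base as Fin using (Fin; zero; suc; toℕ; fromℕ; fromℕ<; inject₁; punchIn)
open import Data.Fin.Patterns using (0F; 1F; 2F)
import Data.Fin.Properties as Fin
open import Data.List.Base as List using (List; length; filter; tabulate; cartesianProductWith; upTo)
import Data.List.Properties as List
open import Data.Nat.Base
open import Data.Nat.Combinatorics using (_C_; nCk+nC[k+1]≡[n+1]C[k+1]; k>n⇒nCk≡0; nCk≡nC[n∸k])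
open import Data.Nat.DivMod
  using (_/_; _%_; 0/n≡0; /-monoˡ-≤; +-distrib-/-∣ʳ; m<n⇒m/n≡0; m*n/n≡m; m/n*n≤m;
         m%n<n; m<n⇒m%n≡m; [m+kn]%n≡m%n; m≡m%n+[m/n]*n)
open import Data.Nat.Divisibility
open import Data.Nat.ListAction using (product)
open import Data.Nat.ListAction.Properties using (product-++)
open import Data.Nat.Properties
open import Data.Nat.Tactic.RingSolver using (solve-∀)
open import Data.Product.Base using (∃; _×_; _,_; proj₁; proj₂)
open import Data.Sum.Base using (inj₁; inj₂)
open import Data.Unit.Base using (⊤; tt)
open import Data.Vec.Base as Vec using (Vec; []; _∷_; lookup)
import Data.Vec.Properties as Vec
open import Data.Vec.Relation.Unary.All as All using (All; []; _∷_)
import Data.Vec.Relation.Unary.All.Properties as All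
open import Data.Vec.Relation.Unary.AllPairs using ([]; _∷_)
open import Data.Vec.Relation.Unary.Unique.Propositional using (Unique)
open import Data.Vec.Relation.Unary.Unique.Propositional.Properties using (lookup-injective)
open import Function.Base using (_∘_; id)
open import Function.Bundles using (mk⇔; Equivalence)
open import Level using (0ℓ)
open import Relation.Binary.Construct.Closure.Transitive as Trans using (TransClosure; _∷_)
open import Relation.Binary.Definitions using (tri<; tri≈; tri>)
open import Relation.Binary.PropositionalEquality
open import Relation.Binary.Structures using (IsDecStrictPartialOrder)
open import Relation.Nullary.Decidable
  using (Dec; yes; no; ¬?; _×-dec_; does; toWitness; dec-true; dec-false)
open import Relation.Nullary.Negation using (¬_; contradiction)
open import Relation.Unary using (Pred; Decidable; _≐_)

open Sum +-*-semiring using (sum; sum-cong-≗; sum-remove; ∑-comm; *-distribˡ-sum; *-distribʳ-sum)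

-- The Rothe numbers are power series coefficients: `rothe k n x` is the coefficient of z^n in B^x,
-- where B = 1 + z B^k, and its recursion reads B^(x+1) = B^x + z B^(x+k). With u = z B^(k-1) one
-- has B (1 - u) = 1, so summing B^x u^b over all b from a on multiplies B^x u^a by B. An ascent for
-- 312 is such a tail sum over the first letter and a descent shifts a by one, so the counts by
-- first letter are the coefficients of B^x u^a. For k = 1 the series is B = 1/(1 - z), which gives
-- the binomials of 213. For 132 a descent sums over the letters below the new one; the transposed
-- step sums over the letters above, so tail sums return if weights on the first letter are pulled
-- back from the whole word to its last letter.

private
  variable
    n ℓ : ℕ
    P Q : Pred (Vec (Fin n) ℓ) 0ℓ

-- Counting words by their first letter

count-cong : (P? : Decidable P) (Q? : Decidable Q) → P ≐ Q → count P? ≡ count Q?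
count-cong {n} {ℓ} P? Q? P≐Q = cong length (List.filter-≐ P? Q? P≐Q (words n ℓ))

length-filter-map : {A B : Set} {P : Pred B 0ℓ} (P? : Decidable P) (f : A → B) (xs : List A) →
                    length (filter P? (List.map f xs)) ≡ length (filter (P? ∘ f) xs)
length-filter-map P? f List.[]       = refl
length-filter-map P? f (x List.∷ xs) with does (P? (f x))
... | true  = cong suc (length-filter-map P? f xs)
... | false = length-filter-map P? f xs

count-∅ : (P? : Decidable P) → (∀ w → ¬ P w) → count P? ≡ 0
count-∅ {n} {ℓ} P? ¬P = go (words n ℓ)
  where
  go : ∀ ws → length (filter P? ws) ≡ 0
  go List.[]       = refl
  go (w List.∷ ws) with P? w
  ... | yes p = contradiction p (¬P w)
  ... | no  _ = go ws

count-∷ : {P : Pred (Vec (Fin n) (suc ℓ)) 0ℓ} (P? : Decidable P) →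
          count P? ≡ sum λ x → count (P? ∘ (x ∷_))
count-∷ {n} {ℓ} P? = go id
  where
  ws = words n ℓ

  go : ∀ {j} (g : Fin j → Fin n) →
       length (filter P? (cartesianProductWith _∷_ (tabulate g) ws)) ≡
       sum λ i → count (P? ∘ (g i ∷_))
  go {zero}  g = refl
  go {suc j} g = begin
    length (filter P? (xs List.++ ys))                     ≡⟨ cong length (List.filter-++ P? xs ys) ⟩
    length (filter P? xs List.++ filter P? ys)             ≡⟨ List.length-++ (filter P? xs) ⟩
    length (filter P? xs) + length (filter P? ys)          ≡⟨ cong₂ _+_ (length-filter-map P? (g zero ∷_) ws) (go (g ∘ suc)) ⟩
    sum (λ i → count (P? ∘ (g i ∷_)))                      ∎
    where
    open ≡-Reasoning
    xs = List.map (g zero ∷_) ws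
    ys = cartesianProductWith _∷_ (tabulate (g ∘ suc)) ws

count-guard : {R : Pred (Vec (Fin n) ℓ) 0ℓ} (R? : Decidable R) (P? : Decidable P) (b : Bool) →
              R ≐ (λ w → T b × P w) → count R? ≡ (if b then count P? else 0)
count-guard R? P? true  (to , from) = count-cong R? P? ((λ r → proj₂ (to r)) , (λ p → from (tt , p)))
count-guard R? P? false (to , from) = count-∅ R? (λ _ r → proj₁ (to r))

-- The letters other than `a` are exactly the values of `punchIn a`, so words without `a` correspond
-- to words over an alphabet with one letter less.
count-punchIn : ∀ {n ℓ} (a : Fin (suc n)) {P : Pred (Vec (Fin (suc n)) ℓ) 0ℓ} (P? : Decidable P) →
                (∀ {w} → P w → All (a ≢_) w) → count P? ≡ count (P? ∘ Vec.map (punchIn a))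
count-punchIn {ℓ = zero}  a P? a∉ with does (P? [])
... | true  = refl
... | false = refl
count-punchIn {ℓ = suc ℓ} a P? a∉ = begin
  count P?                                                       ≡⟨ count-∷ P? ⟩
  sum (λ x → count (P? ∘ (x ∷_)))                                ≡⟨ sum-remove {i = a} (λ x → count (P? ∘ (x ∷_))) ⟩
  count (P? ∘ (a ∷_)) + sum (λ y → count (P? ∘ (punchIn a y ∷_)))
    ≡⟨ cong₂ _+_ (count-∅ (P? ∘ (a ∷_)) λ _ p → All.head (a∉ p) refl)
                 (sum-cong-≗ λ y → count-punchIn a (P? ∘ (punchIn a y ∷_)) (All.tail ∘ a∉)) ⟩
  sum (λ y → count (P? ∘ (punchIn a y ∷_) ∘ Vec.map (punchIn a))) ≡⟨ count-∷ (P? ∘ Vec.map (punchIn a)) ⟨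
  count (P? ∘ Vec.map (punchIn a))                               ∎
  where open ≡-Reasoning

-- Pigeonhole: punching out a missed letter would embed `Fin (suc n)` injectively into `Fin n`.
Unique⇒surjective : {π : Vec (Fin n) n} → Unique π → ∀ c → ∃ λ i → lookup π i ≡ c
Unique⇒surjective {suc n} {π} u c with Fin.any? (λ i → lookup π i Fin.≟ c)
... | yes hit = hit
... | no miss = contradiction
  (λ {i} {j} eq → lookup-injective u i j (Fin.punchOut-injective (c≢ i) (c≢ j) eq))
  (Fin.<⇒notInjective (n<1+n n))
  where
  c≢ : ∀ i → c ≢ lookup π i
  c≢ i eq = miss (i , sym eq)

-- Raising letters past a new one, and the transfer recursion

punchIn-mono-< : ∀ (a : Fin (suc n)) {i j : Fin n} → i Fin.< j → punchIn a i Fin.< punchIn a j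
punchIn-mono-< a i<j = ≰⇒> (<⇒≱ i<j ∘ Fin.punchIn-cancel-≤ a _ _)

punchIn-cancel-< : ∀ (a : Fin (suc n)) {i j : Fin n} → punchIn a i Fin.< punchIn a j → i Fin.< j
punchIn-cancel-< a i<j = ≰⇒> (<⇒≱ i<j ∘ Fin.punchIn-mono-≤ a _ _)

data PunchIn (a c : ℕ) : ℕ → Set where
  below : c < a → PunchIn a c c
  above : a ≤ c → PunchIn a c (suc c)

toℕ-punchIn : ∀ (a : Fin (suc n)) (c : Fin n) → PunchIn (toℕ a) (toℕ c) (toℕ (punchIn a c))
toℕ-punchIn zero    c       = above z≤n
toℕ-punchIn (suc a) zero    = below z<s
toℕ-punchIn (suc a) (suc c) with toℕ (punchIn a c) | toℕ-punchIn a c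
... | _ | below c<a = below (s<s c<a)
... | _ | above a≤c = above (s≤s a≤c)

-- The order type of a three-letter pattern: lo, mid and hi are the places of
-- its smallest, middle and largest letter.
Occurs : (lo mid hi : Fin 3) → Fin n → Fin n → Fin n → Set
Occurs lo mid hi x y z = lookup v lo Fin.< lookup v mid × lookup v mid Fin.< lookup v hi
  where v = x ∷ y ∷ z ∷ []

Directed : Bool → Fin n → Fin n → Set
Directed true  x y = y Fin.< x
Directed false x y = x Fin.< y

directed? : ∀ d (x y : Fin n) → Dec (Directed d x y)
directed? true  x y = y Fin.<? x
directed? false x y = x Fin.<? y

Directed-punchIn⁺ : ∀ d (a : Fin (suc n)) {x y} → Directed d x y → Directed d (punchIn a x) (punchIn a y)
Directed-punchIn⁺ true  a = punchIn-mono-< a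
Directed-punchIn⁺ false a = punchIn-mono-< a

Directed-punchIn⁻ : ∀ d (a : Fin (suc n)) {x y} → Directed d (punchIn a x) (punchIn a y) → Directed d x y
Directed-punchIn⁻ true  a = punchIn-cancel-< a
Directed-punchIn⁻ false a = punchIn-cancel-< a

-- Prepending the letter a to a permutation of length L starting with b turns
-- that letter into punchIn a b; every further letter occurs later on.
Extends : (lo mid hi : Fin 3) → Bool → ∀ {L} → Fin (suc L) → Fin L → Set
Extends lo mid hi d a b = Directed d a y × (∀ z → z ≢ a → z ≢ y → ¬ Occurs lo mid hi a y z)
  where y = punchIn a b

-- Steps act on natural numbers rather than on `Fin`, so that the counts for suffixes of all lengths
-- are functions on one domain and can be compared with closed forms.
Step : Set
Step = Bool → (L a b : ℕ) → Bool

Correct : (lo mid hi : Fin 3) → Step → Set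
Correct lo mid hi step = ∀ d {L} (a : Fin (suc L)) (b : Fin L) →
  (Extends lo mid hi d a b → T (step d L (toℕ a) (toℕ b))) ×
  (T (step d L (toℕ a) (toℕ b)) → Extends lo mid hi d a b)

sumBelow : ℕ → (ℕ → ℕ) → ℕ
sumBelow n f = sum {n} (f ∘ toℕ)

-- desc L is the direction in which a suffix of length L is entered.
module Transfer (desc : ℕ → Bool) (step : Step) where

  -- ways ℓ a counts the words of length ℓ + 1 with first letter a.
  ways : ℕ → ℕ → ℕ
  ways zero    a = 1
  ways (suc ℓ) a = sumBelow (suc ℓ) λ b → if step (desc (suc ℓ)) (suc ℓ) a b then ways ℓ b else 0

  -- With `d` a variable, a known value of `desc (suc ℓ)` reduces `step` by computation alone.
  ways-suc : ∀ {ℓ d} a → desc (suc ℓ) ≡ d →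
             ways (suc ℓ) a ≡ sumBelow (suc ℓ) (λ b → if step d (suc ℓ) a b then ways ℓ b else 0)
  ways-suc a refl = refl

  total : ℕ → ℕ
  total ℓ = sumBelow (suc ℓ) (ways ℓ)

-- Avoiding words with prescribed directions, suffix by suffix

module Words (lo mid hi : Fin 3) (desc : ℕ → Bool) where

  Occ : Fin n → Fin n → Fin n → Set
  Occ = Occurs lo mid hi

  Occ-punchIn⁺ : ∀ (a : Fin (suc n)) {x y z} → Occ x y z → Occ (punchIn a x) (punchIn a y) (punchIn a z)
  Occ-punchIn⁺ a {x} {y} {z} (p , q)
    rewrite Vec.lookup-map lo (punchIn a) (x ∷ y ∷ z ∷ [])
          | Vec.lookup-map mid (punchIn a) (x ∷ y ∷ z ∷ [])
          | Vec.lookup-map hi (punchIn a) (x ∷ y ∷ z ∷ [])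
    = punchIn-mono-< a p , punchIn-mono-< a q

  Occ-punchIn⁻ : ∀ (a : Fin (suc n)) {x y z} → Occ (punchIn a x) (punchIn a y) (punchIn a z) → Occ x y z
  Occ-punchIn⁻ a {x} {y} {z} (p , q)
    rewrite Vec.lookup-map lo (punchIn a) (x ∷ y ∷ z ∷ [])
          | Vec.lookup-map mid (punchIn a) (x ∷ y ∷ z ∷ [])
          | Vec.lookup-map hi (punchIn a) (x ∷ y ∷ z ∷ [])
    = punchIn-cancel-< a p , punchIn-cancel-< a q

  -- Alphabet and length are independent because a proper suffix of a permutation is shorter than
  -- its alphabet. Directions are indexed by the length of the suffix `y ∷ w`, hence do not change
  -- when letters are prepended.
  Good : Vec (Fin n) ℓ → Set
  Good []                            = ⊤
  Good (x ∷ [])                      = ⊤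
  Good {ℓ = suc (suc ℓ)} (x ∷ y ∷ w) =
    All (x ≢_) (y ∷ w) × (Directed (desc (suc ℓ)) x y × All (¬_ ∘ Occ x y) w) × Good (y ∷ w)

  good? : (w : Vec (Fin n) ℓ) → Dec (Good w)
  good? []          = yes tt
  good? (x ∷ [])    = yes tt
  good? (x ∷ y ∷ w) =
    All.all? (λ z → ¬? (x Fin.≟ z)) (y ∷ w)
    ×-dec (directed? _ x y ×-dec All.all? (λ z → ¬? (_ Fin.<? _ ×-dec _ Fin.<? _)) w)
    ×-dec good? (y ∷ w)

  Good⇒Unique : (w : Vec (Fin n) ℓ) → Good w → Unique w
  Good⇒Unique []          _            = []
  Good⇒Unique (x ∷ [])    _            = [] ∷ []
  Good⇒Unique (x ∷ y ∷ w) (x∉ , _ , g) = x∉ ∷ Good⇒Unique (y ∷ w) g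

  Good-punchIn⁺ : ∀ (a : Fin (suc n)) (w : Vec (Fin n) ℓ) → Good w → Good (Vec.map (punchIn a) w)
  Good-punchIn⁺ a []          _ = tt
  Good-punchIn⁺ a (x ∷ [])    _ = tt
  Good-punchIn⁺ a (x ∷ y ∷ w) (x∉ , (d , ¬occ) , g) =
    All.map⁺ (All.map (_∘ Fin.punchIn-injective a _ _) x∉) ,
    (Directed-punchIn⁺ _ a d , All.map⁺ (All.map (_∘ Occ-punchIn⁻ a) ¬occ)) ,
    Good-punchIn⁺ a (y ∷ w) g

  Good-punchIn⁻ : ∀ (a : Fin (suc n)) (w : Vec (Fin n) ℓ) → Good (Vec.map (punchIn a) w) → Good w
  Good-punchIn⁻ a []          _ = tt
  Good-punchIn⁻ a (x ∷ [])    _ = tt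
  Good-punchIn⁻ a (x ∷ y ∷ w) (x∉ , (d , ¬occ) , g) =
    All.map (_∘ cong (punchIn a)) (All.map⁻ x∉) ,
    (Directed-punchIn⁻ _ a d , All.map (_∘ Occ-punchIn⁺ a) (All.map⁻ ¬occ)) ,
    Good-punchIn⁻ a (y ∷ w) g

  module _ (step : Step) (correct : Correct lo mid hi step) where

    open Transfer desc step

    -- The left side tests only third letters found in `w`, while `Extends` tests every letter
    -- except `a` and `y`. The two agree because `b ∷ w` is repetition-free of full length and so
    -- contains all letters.
    Good-∷ : ∀ {ℓ} (a : Fin (suc (suc ℓ))) (b : Fin (suc ℓ)) →
             (λ (w : Vec (Fin (suc ℓ)) ℓ) → Good (a ∷ Vec.map (punchIn a) (b ∷ w))) ≐
             (λ w → T (step (desc (suc ℓ)) (suc ℓ) (toℕ a) (toℕ b)) × Good (b ∷ w))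
    Good-∷ {ℓ} a b = to , from
      where
      y = punchIn a b

      to : ∀ {w} → Good (a ∷ Vec.map (punchIn a) (b ∷ w)) →
           T (step (desc (suc ℓ)) (suc ℓ) (toℕ a) (toℕ b)) × Good (b ∷ w)
      to {w} (a∉ , (d , ¬occ) , g) = proj₁ (correct (desc _) a b) (d , no-occ) , g′
        where
        g′ = Good-punchIn⁻ a (b ∷ w) g

        no-occ : ∀ z → z ≢ a → z ≢ y → ¬ Occ a y z
        -- Undo the raising of `z` and locate the result in `b ∷ w`; at the front it would give z =
        -- y, elsewhere it is a tested third letter.
        no-occ z z≢a z≢y occ with Unique⇒surjective (Good⇒Unique (b ∷ w) g′) (Fin.punchOut (z≢a ∘ sym))
        ... | zero  , refl = z≢y (sym (Fin.punchIn-punchOut (z≢a ∘ sym)))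
        ... | suc i , eq   = All.lookup⁺ (All.map⁻ ¬occ) i (subst (Occ a y) z≡ occ)
          where
          z≡ : z ≡ punchIn a (lookup w i)
          z≡ = trans (sym (Fin.punchIn-punchOut (z≢a ∘ sym))) (cong (punchIn a) (sym eq))

      from : ∀ {w} → T (step (desc (suc ℓ)) (suc ℓ) (toℕ a) (toℕ b)) × Good (b ∷ w) →
             Good (a ∷ Vec.map (punchIn a) (b ∷ w))
      from {w} (t , g) with proj₂ (correct (desc _) a b) t | Good⇒Unique (b ∷ w) g
      ... | d , no-occ | b∉ ∷ _ =
        All.map⁺ (All.universal (λ c → Fin.punchInᵢ≢i a c ∘ sym) (b ∷ w)) ,
        (d , All.map⁺ (All.map (λ {c} b≢c → no-occ (punchIn a c) (Fin.punchInᵢ≢i a c)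
                                (b≢c ∘ sym ∘ Fin.punchIn-injective a c b)) b∉)) ,
        Good-punchIn⁺ a (b ∷ w) g

    count-first : ∀ ℓ (a : Fin (suc ℓ)) → count {ℓ = ℓ} (λ w → good? (a ∷ w)) ≡ ways ℓ (toℕ a)
    count-first zero    a = refl
    count-first (suc ℓ) a = begin
      count prepended?                                            ≡⟨ count-punchIn a prepended? (λ { {_ ∷ _} (a∉ , _) → a∉ }) ⟩
      count inserted?                                             ≡⟨ count-∷ inserted? ⟩
      sum (λ b → count (inserted? ∘ (b ∷_)))                      ≡⟨ sum-cong-≗ by-second-letter ⟩
      ways (suc ℓ) (toℕ a)                                        ∎
      where
      open ≡-Reasoning
      prepended? = λ (w : Vec (Fin (suc (suc ℓ))) (suc ℓ)) → good? (a ∷ w)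
      inserted?  = prepended? ∘ Vec.map (punchIn a)

      by-second-letter : ∀ b → count (inserted? ∘ (b ∷_)) ≡
                         (if step (desc (suc ℓ)) (suc ℓ) (toℕ a) (toℕ b) then ways ℓ (toℕ b) else 0)
      by-second-letter b = trans
        (count-guard (inserted? ∘ (b ∷_)) (λ w → good? (b ∷ w)) _ (Good-∷ a b))
        (cong (if step (desc (suc ℓ)) (suc ℓ) (toℕ a) (toℕ b) then_else 0) (count-first ℓ b))

    count-good : ∀ ℓ → count {suc ℓ} {suc ℓ} good? ≡ total ℓ
    count-good ℓ = trans (count-∷ {suc ℓ} {ℓ} good?) (sum-cong-≗ (count-first ℓ))

-- Permutations in 𝒟 N k through their adjacent letters

m≤n∸1⇒m<n : ∀ {m n} → 0 < m → m ≤ n ∸ 1 → m < n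
m≤n∸1⇒m<n {n = suc n} _   m≤n = s≤s m≤n
m≤n∸1⇒m<n {n = zero}  0<m m≤0 = contradiction m≤0 (<⇒≱ 0<m)

-- Together with the converse below, this trades the bound by the floor of (N - 1)/k for 0 < i < N,
-- which holds for the index of any letter that has a predecessor. Only divisibility remains to be
-- checked.
∣⇒Multiples : ∀ {N} k .{{_ : NonZero k}} {i} → 0 < i → i < N → k ∣ i → Multiples N k i
∣⇒Multiples {N} k {i} 0<i i<N (divides j i≡) = j , 1≤j , j≤ , trans i≡ (*-comm j k)
  where
  1≤j : 1 ≤ j
  1≤j = n≢0⇒n>0 λ { refl → <⇒≢ 0<i (sym i≡) }
  j≤ : j ≤ (N ∸ 1) / k
  j≤ = subst (_≤ (N ∸ 1) / k) (m*n/n≡m j k) (/-monoˡ-≤ k (subst (_≤ N ∸ 1) i≡ (∸-monoˡ-≤ 1 i<N)))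

Multiples⇒∣ : ∀ {N} k .{{_ : NonZero k}} {i} → Multiples N k i → k ∣ i × 0 < i × i < N
Multiples⇒∣ {N} k (j , 1≤j , j≤ , refl) = m∣m*n j , 0<kj ,
  m≤n∸1⇒m<n 0<kj (≤-trans (*-monoʳ-≤ k j≤) (subst (_≤ N ∸ 1) (*-comm ((N ∸ 1) / k) k) (m/n*n≤m (N ∸ 1) k)))
  where
  0<kj : 0 < k * j
  0<kj = *-mono-< {0} {k} {0} {j} (>-nonZero⁻¹ k) 1≤j

module WordsIndexed (lo mid hi : Fin 3) (desc : ℕ → Bool) where

  open Words lo mid hi desc

  -- Here `ℓ ∸ toℕ q` is the length of the suffix starting at `q`.
  GoodAt : Vec (Fin n) ℓ → Set
  GoodAt {ℓ = ℓ} w = ∀ p q → toℕ q ≡ suc (toℕ p) →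
    Directed (desc (ℓ ∸ toℕ q)) (lookup w p) (lookup w q) ×
    (∀ r → q Fin.< r → ¬ Occ (lookup w p) (lookup w q) (lookup w r))

  Good⇒GoodAt : (w : Vec (Fin n) ℓ) → Good w → GoodAt w
  Good⇒GoodAt (x ∷ [])    _                  0F      0F            ()
  Good⇒GoodAt (x ∷ y ∷ w) (_ , (d , av) , _) 0F      1F            refl =
    d , λ { (suc (suc r)) _ → All.lookup⁺ av r ; 1F (s<s ()) }
  Good⇒GoodAt (x ∷ y ∷ w) _                  0F      (suc (suc q)) ()
  Good⇒GoodAt (x ∷ y ∷ w) (_ , _ , g)        (suc p) (suc q)       e    =
    let d , av = Good⇒GoodAt (y ∷ w) g p q (suc-injective e)
    in  d , λ { (suc r) (s<s q<r) → av r q<r }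

  GoodAt⇒Good : (w : Vec (Fin n) ℓ) → Unique w → GoodAt w → Good w
  GoodAt⇒Good []          _        _ = tt
  GoodAt⇒Good (x ∷ [])    _        _ = tt
  GoodAt⇒Good (x ∷ y ∷ w) (x∉ ∷ u) g =
    x∉ , (proj₁ (g 0F 1F refl) , All.lookup⁻ λ r → proj₂ (g 0F 1F refl) (suc (suc r)) (s<s z<s)) ,
    GoodAt⇒Good (y ∷ w) u λ p q e →
      let d , av = g (suc p) (suc q) (cong suc e) in d , λ r q<r → av (suc r) (s<s q<r)

increasing : ∀ (f : Fin 3 → ℕ) → f 0F < f 1F → f 1F < f 2F → ∀ {i j} → i Fin.< j → f i < f j
increasing f f₀<f₁ f₁<f₂ {0F} {1F} _         = f₀<f₁
increasing f f₀<f₁ f₁<f₂ {0F} {2F} _         = <-trans f₀<f₁ f₁<f₂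
increasing f f₀<f₁ f₁<f₂ {1F} {1F} (s<s ())
increasing f f₀<f₁ f₁<f₂ {1F} {2F} _         = f₁<f₂
increasing f f₀<f₁ f₁<f₂ {2F} {1F} (s<s ())
increasing f f₀<f₁ f₁<f₂ {2F} {2F} (s<s (s<s ()))

increasing-transfer : ∀ (f g : Fin 3 → ℕ) → f 0F < f 1F → f 1F < f 2F → g 0F < g 1F → g 1F < g 2F →
                      ∀ {i j} → f i < f j → g i < g j
increasing-transfer f g f₀<f₁ f₁<f₂ g₀<g₁ g₁<g₂ {i} {j} fi<fj with Fin.<-cmp i j
... | tri< i<j _ _  = increasing g g₀<g₁ g₁<g₂ i<j
... | tri≈ _ refl _ = contradiction fi<fj (<-irrefl refl)
... | tri> _ _ j<i  = contradiction fi<fj (<-asym (increasing f f₀<f₁ f₁<f₂ j<i))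

-- `lo`, `mid`, `hi` form the inverse permutation of `abc`. Since they exhaust the three places, the
-- two inequalities of `Occurs` determine all comparisons in `SameRelativeOrder`.
module Pattern
  (abc : Vec ℕ 3) (lo mid hi : Fin 3)
  (places : ∀ i → ∃ λ r → lookup (lo ∷ mid ∷ hi ∷ []) r ≡ i)
  (lo<mid : lookup abc lo < lookup abc mid) (mid<hi : lookup abc mid < lookup abc hi)
  where

  module _ {n} (π : Vec (Fin n) n) (p q r : Fin n) where

    private
      values : Vec ℕ 3
      values = Vec.map (toℕ ∘ lookup π) (p ∷ q ∷ r ∷ [])

      letters : Vec (Fin n) 3
      letters = lookup π p ∷ lookup π q ∷ lookup π r ∷ []

      lookup-letters : ∀ i → lookup values i ≡ toℕ (lookup letters i)
      lookup-letters 0F = refl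
      lookup-letters 1F = refl
      lookup-letters 2F = refl

    order⇒Occurs : SameRelativeOrder values abc → Occurs lo mid hi (lookup π p) (lookup π q) (lookup π r)
    order⇒Occurs sro =
      subst₂ _<_ (lookup-letters lo) (lookup-letters mid) (Equivalence.from (sro lo mid) lo<mid) ,
      subst₂ _<_ (lookup-letters mid) (lookup-letters hi) (Equivalence.from (sro mid hi) mid<hi)

    Occurs⇒order : Occurs lo mid hi (lookup π p) (lookup π q) (lookup π r) → SameRelativeOrder values abc
    Occurs⇒order (l<m , m<h) i j with places i | places j
    ... | i′ , refl | j′ , refl = mk⇔
      (increasing-transfer f g f₀<f₁ f₁<f₂ lo<mid mid<hi {i′} {j′})
      (increasing-transfer g f lo<mid mid<hi f₀<f₁ f₁<f₂ {i′} {j′})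
      where
      f g : Fin 3 → ℕ
      f = lookup values ∘ lookup (lo ∷ mid ∷ hi ∷ [])
      g = lookup abc ∘ lookup (lo ∷ mid ∷ hi ∷ [])
      f₀<f₁ = subst₂ _<_ (sym (lookup-letters lo)) (sym (lookup-letters mid)) l<m
      f₁<f₂ = subst₂ _<_ (sym (lookup-letters mid)) (sym (lookup-letters hi)) m<h

  -- k≢0 is a parameter, passed on explicitly, because instance search for
  -- NonZero k may otherwise commit to m+n-nonZero from Defs.
  module Schedule (N k : ℕ) .{{k≢0 : NonZero k}} .{{k≥2 : NonTrivial k}} where

    -- The suffix of length `L` starts at index `N ∸ L` counted from 0, which is the position,
    -- counted from 1, of the letter before it and so of the possible descent.
    descent? : ℕ → Bool
    descent? L = does (k ∣? (N ∸ L))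

    open Words lo mid hi descent?
    open WordsIndexed lo mid hi descent?

    Scheduled : Vec (Fin N) N → Set
    Scheduled π = ∀ p q → toℕ q ≡ suc (toℕ p) →
      (k ∣ toℕ q → lookup π q Fin.< lookup π p) × (¬ k ∣ toℕ q → lookup π p Fin.< lookup π q)

    Avoids : Vec (Fin N) N → Set
    Avoids π = ∀ p q r → toℕ q ≡ suc (toℕ p) → q Fin.< r → ¬ Occ (lookup π p) (lookup π q) (lookup π r)

    𝒟Avoiding⇒ : ∀ {π} → 𝒟Avoiding N k abc π → Unique π × Scheduled π × Avoids π
    𝒟Avoiding⇒ {π} ((u , Des⊆ , ⊆Des) , avoids) = u , scheduled ,
      λ p q r e q<r occ → avoids (p , q , r , e , q<r , Occurs⇒order π p q r occ)
      where
      scheduled : Scheduled π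
      scheduled p q e = down , up
        where
        down : k ∣ toℕ q → lookup π q Fin.< lookup π p
        down k∣q with ⊆Des (∣⇒Multiples k {{k≢0}} (subst (0 <_) (sym e) z<s) (Fin.toℕ<n q) k∣q)
        ... | p′ , q′ , ep , eq , d with Fin.toℕ-injective {i = q′} {j = q} eq
                                       | Fin.toℕ-injective {i = p′} {j = p} (suc-injective (trans ep e))
        ... | refl | refl = d

        up : ¬ k ∣ toℕ q → lookup π p Fin.< lookup π q
        up k∤q with Fin.<-cmp (lookup π p) (lookup π q)
        ... | tri< lt _ _ = lt
        ... | tri≈ _ eq _ = contradiction (cong toℕ (lookup-injective u p q eq)) λ p≡q → 1+n≢n (trans (sym e) (sym p≡q))
        ... | tri> _ _ gt with Des⊆ (p , q , sym e , refl , gt)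
        ... | j , _ , _ , eq = contradiction (divides j (trans eq (*-comm k j))) k∤q

    ⇒𝒟Avoiding : ∀ {π} → Unique π × Scheduled π × Avoids π → 𝒟Avoiding N k abc π
    ⇒𝒟Avoiding {π} (u , scheduled , avoids) = (u , Des⊆ , ⊆Des) ,
      λ (p , q , r , e , q<r , sro) → avoids p q r e q<r (order⇒Occurs π p q r sro)
      where
      Des⊆ : ∀ {i} → Des π i → Multiples N k i
      Des⊆ (p , q , ep , refl , d) with k ∣? toℕ q
      ... | no k∤q = contradiction d (<-asym (proj₂ (scheduled p q (sym ep)) k∤q))
      ... | yes k∣q = ∣⇒Multiples k {{k≢0}} (subst (0 <_) ep z<s) (Fin.toℕ<n q) k∣q

      ⊆Des : ∀ {i} → Multiples N k i → Des π i
      ⊆Des {i} i∈ with Multiples⇒∣ k {{k≢0}} i∈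
      ... | k∣i , 0<i , i<N = p , q , trans (cong suc (Fin.toℕ-fromℕ< p<N)) suc-p , q≡ ,
        proj₁ (scheduled p q (trans q≡ (trans (sym suc-p) (cong suc (sym (Fin.toℕ-fromℕ< p<N))))))
              (subst (k ∣_) (sym q≡) k∣i)
        where
        suc-p : suc (pred i) ≡ i
        suc-p = suc-pred i {{>-nonZero 0<i}}
        p<N : pred i < N
        p<N = ≤-<-trans (pred[n]≤n {i}) i<N
        p = fromℕ< p<N
        q = fromℕ< i<N
        q≡ : toℕ q ≡ i
        q≡ = Fin.toℕ-fromℕ< i<N

    descent?-position : ∀ (q : Fin N) → descent? (N ∸ toℕ q) ≡ does (k ∣? toℕ q)
    descent?-position q = cong (λ i → does (k ∣? i)) (m∸[m∸n]≡n (<⇒≤ (Fin.toℕ<n q)))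

    Good⇒Scheduled : ∀ {π : Vec (Fin N) N} → Good π → Unique π × Scheduled π × Avoids π
    Good⇒Scheduled {π} g = Good⇒Unique π g , scheduled ,
      λ p q r e → proj₂ (Good⇒GoodAt π g p q e) r
      where
      scheduled : Scheduled π
      scheduled p q e with d ← proj₁ (Good⇒GoodAt π g p q e)
        rewrite descent?-position q with k ∣? toℕ q
      ... | yes k∣q = (λ _ → d) , contradiction k∣q
      ... | no  k∤q = (λ k∣q → contradiction k∣q k∤q) , λ _ → d

    Scheduled⇒Good : ∀ {π : Vec (Fin N) N} → Unique π × Scheduled π × Avoids π → Good π
    Scheduled⇒Good {π} (u , scheduled , avoids) = GoodAt⇒Good π u λ p q e →
      directed p q e , λ r → avoids p q r e
      where
      directed : ∀ p q → toℕ q ≡ suc (toℕ p) → Directed (descent? (N ∸ toℕ q)) (lookup π p) (lookup π q)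
      directed p q e rewrite descent?-position q with k ∣? toℕ q
      ... | yes k∣q = proj₁ (scheduled p q e) k∣q
      ... | no  k∤q = proj₂ (scheduled p q e) k∤q

    ∣𝒟∣≡count-good : ∣𝒟 N , k ⟨ abc ⟩∣ ≡ count (good? {N} {N})
    ∣𝒟∣≡count-good = count-cong (𝒟Avoiding? N k abc) good?
      ((λ π∈ → Scheduled⇒Good (𝒟Avoiding⇒ π∈)) , (λ g → ⇒𝒟Avoiding (Good⇒Scheduled g)))

  ∣𝒟∣≡total : ∀ N k .{{_ : NonTrivial k}} {step} → Correct lo mid hi step → ∀ {ℓ} → N ≡ suc ℓ →
              ∣𝒟 N , k ⟨ abc ⟩∣ ≡ Transfer.total (λ L → does (k ∣? (N ∸ L))) step ℓ
  ∣𝒟∣≡total N k {step} correct {ℓ} refl = trans (Schedule.∣𝒟∣≡count-good N k {{nonTrivial⇒nonZero k}})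
    (Words.count-good lo mid hi (λ L → does (k ∣? (N ∸ L))) step correct ℓ)

places? : (lo mid hi : Fin 3) → Dec (∀ i → ∃ λ r → lookup (lo ∷ mid ∷ hi ∷ []) r ≡ i)
places? lo mid hi = Fin.all? λ i → Fin.any? λ r → lookup (lo ∷ mid ∷ hi ∷ []) r Fin.≟ i

module P123 = Pattern (1 ∷ 2 ∷ 3 ∷ []) 0F 1F 2F (toWitness {a? = places? 0F 1F 2F} tt) (n<1+n 1) (n<1+n 2)
module P132 = Pattern (1 ∷ 3 ∷ 2 ∷ []) 0F 2F 1F (toWitness {a? = places? 0F 2F 1F} tt) (n<1+n 1) (n<1+n 2)
module P213 = Pattern (2 ∷ 1 ∷ 3 ∷ []) 1F 0F 2F (toWitness {a? = places? 1F 0F 2F} tt) (n<1+n 1) (n<1+n 2)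
module P231 = Pattern (2 ∷ 3 ∷ 1 ∷ []) 2F 0F 1F (toWitness {a? = places? 2F 0F 1F} tt) (n<1+n 1) (n<1+n 2)
module P312 = Pattern (3 ∷ 1 ∷ 2 ∷ []) 1F 2F 0F (toWitness {a? = places? 1F 2F 0F} tt) (n<1+n 1) (n<1+n 2)
module P321 = Pattern (3 ∷ 2 ∷ 1 ∷ []) 2F 1F 0F (toWitness {a? = places? 2F 1F 0F} tt) (n<1+n 1) (n<1+n 2)

-- Pattern 321 and linear extensions

/-%-unique : ∀ {n k} .{{_ : NonZero k}} b {o} → o < k → n ≡ o + b * k → n / k ≡ b × n % k ≡ o
/-%-unique {k = k} b {o} o<k refl =
  trans (+-distrib-/-∣ʳ o (n∣m*n b)) (cong₂ _+_ (m<n⇒m/n≡0 o<k) (m*n/n≡m b k)) ,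
  trans ([m+kn]%n≡m%n o b k) (m<n⇒m%n≡m o<k)

module _ (m s k : ℕ) .{{k≢0 : NonZero k}} .{{k≥2 : NonTrivial k}} where

  private
    N = m * k + s

  open P321.Schedule N k

  position : (p : Position m s k) → toℕ p ≡ offset m s k p + block m s k p * k
  position p = m≡m%n+[m/n]*n (toℕ p) k {{k≢0}}

  ∣⇒offset≡0 : (p : Position m s k) → k ∣ toℕ p → offset m s k p ≡ 0
  ∣⇒offset≡0 p = n∣m⇒m%n≡0 (toℕ p) k {{k≢0}}

  offset≡0⇒∣ : (p : Position m s k) → offset m s k p ≡ 0 → k ∣ toℕ p
  offset≡0⇒∣ p = m%n≡0⇒n∣m (toℕ p) k {{k≢0}}

  -- Either `p` is not the last position of a full block, and the pair lies within a block, or `q`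
  -- opens the next block, and the generator points backwards.
  adjacent : (p q : Position m s k) → toℕ q ≡ suc (toℕ p) →
             (k ∣ toℕ q → BlockGenerator m s k q p) × (¬ k ∣ toℕ q → BlockGenerator m s k p q)
  adjacent p q e with suc (offset m s k p) <? k
  ... | yes o+1<k with b≡ , o≡ ← /-%-unique {{k≢0}} (block m s k p) o+1<k (trans e (cong suc (position p)))
    = (λ k∣q → contradiction (trans (sym o≡) (∣⇒offset≡0 q k∣q)) 1+n≢0) , λ _ → within (sym b≡) o≡
  ... | no o+1≮k with o+1≡k ← ≤-antisym (m%n<n (toℕ p) k {{k≢0}}) (≮⇒≥ o+1≮k)
                 with b≡ , o≡ ← /-%-unique {{k≢0}} (suc (block m s k p)) (>-nonZero⁻¹ k {{k≢0}})
                                  (trans e (trans (cong suc (position p)) (cong (_+ block m s k p * k) o+1≡k)))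
    = (λ _ → across b≡ o≡ (cong pred o+1≡k)) , contradiction (offset≡0⇒∣ q o≡)

  module _ {π : Vec (Fin N) N} where

    LinearExtension⇒Scheduled : IsLinearExtension (P³²¹ m s k) π → Unique π × Scheduled π × Avoids π
    LinearExtension⇒Scheduled (u , mono) = u , scheduled , avoids
      where
      generator : ∀ {p q} → BlockGenerator m s k p q → lookup π p Fin.< lookup π q
      generator g = mono _ _ Trans.[ inj₁ Trans.[ g ] ]

      scheduled : Scheduled π
      scheduled p q e = generator ∘ proj₁ (adjacent p q e) , generator ∘ proj₂ (adjacent p q e)

      avoids : Avoids π
      avoids p q r e q<r (r<q , q<p) with k ∣? toℕ q
      ... | no k∤q  = <-asym q<p (proj₂ (scheduled p q e) k∤q)
      -- A descent can only end at the first position of a later block, and that position is below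
      -- everything to its right.
      ... | yes k∣q = <-asym r<q (mono q r Trans.[ inj₂ (1≤block , o≡0 , q<r) ])
        where
        o≡0 = ∣⇒offset≡0 q k∣q
        1≤block : 1 ≤ block m s k q
        1≤block = n≢0⇒n>0 λ b≡0 → 1+n≢0 (trans (sym e) (trans (position q) (cong₂ (λ o b → o + b * k) o≡0 b≡0)))

    Scheduled⇒LinearExtension : Unique π × Scheduled π × Avoids π → IsLinearExtension (P³²¹ m s k) π
    Scheduled⇒LinearExtension (u , scheduled , avoids) = u , λ p q → closure {p} {q}
      where
      generator : ∀ {p q} → BlockGenerator m s k p q → lookup π p Fin.< lookup π q
      generator {p} {q} (within b≡ o≡) = proj₂ (scheduled p q e) λ k∣q →
        1+n≢0 (trans (sym o≡) (∣⇒offset≡0 q k∣q))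
        where
        e : toℕ q ≡ suc (toℕ p)
        e = trans (position q) (trans (cong₂ (λ o b → o + b * k) o≡ (sym b≡)) (cong suc (sym (position p))))
      generator {p} {q} (across b≡ op≡ oq≡) = proj₁ (scheduled q p e) (offset≡0⇒∣ p op≡)
        where
        e : toℕ p ≡ suc (toℕ q)
        e = begin
          toℕ p                              ≡⟨ position p ⟩
          offset m s k p + block m s k p * k ≡⟨ cong₂ (λ o b → o + b * k) op≡ b≡ ⟩
          k + block m s k q * k              ≡⟨ cong (_+ block m s k q * k) (suc-pred k) ⟨
          suc (pred k) + block m s k q * k   ≡⟨ cong (λ o → suc o + block m s k q * k) oq≡ ⟨
          suc (offset m s k q + block m s k q * k) ≡⟨ cong suc (position q) ⟨
          suc (toℕ q) ∎
          where open ≡-Reasoning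

      first : ∀ {p q} → FirstBelowRight m s k p q → lookup π p Fin.< lookup π q
      first {p} {q} (1≤b , o≡0 , p<q) with Fin.<-cmp (lookup π p) (lookup π q)
      ... | tri< lt _ _ = lt
      ... | tri≈ _ eq _ = contradiction (cong toℕ (lookup-injective u p q eq)) (<⇒≢ p<q)
      -- The forced descent puts a larger letter just before `p`; with a smaller letter at `q` this
      -- would be an occurrence of 321.
      ... | tri> _ _ gt = contradiction (gt , proj₁ (scheduled p⁻ p e) k∣p) (avoids p⁻ p q e p<q)
        where
        k∣p = offset≡0⇒∣ p o≡0
        0<p : 0 < toℕ p
        0<p = n≢0⇒n>0 λ p≡0 → <⇒≢ 1≤b (sym (trans (cong (λ i → _/_ i k {{k≢0}}) p≡0) (0/n≡0 k {{k≢0}})))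
        p⁻<N : pred (toℕ p) < N
        p⁻<N = ≤-<-trans (pred[n]≤n {toℕ p}) (Fin.toℕ<n p)
        p⁻ = fromℕ< p⁻<N
        e : toℕ p ≡ suc (toℕ p⁻)
        e = trans (sym (suc-pred (toℕ p) {{>-nonZero 0<p}})) (cong suc (sym (Fin.toℕ-fromℕ< p⁻<N)))

      closure⁺ : ∀ {R : Fin N → Fin N → Set} → (∀ {p q} → R p q → lookup π p Fin.< lookup π q) →
                 ∀ {p q} → TransClosure R p q → lookup π p Fin.< lookup π q
      closure⁺ mono Trans.[ r ] = mono r
      closure⁺ mono (r ∷ rs)    = <-trans (mono r) (closure⁺ mono rs)

      closure : ∀ {p q} → P³²¹ m s k p q → lookup π p Fin.< lookup π q
      closure = closure⁺ λ { (inj₁ b) → closure⁺ generator b ; (inj₂ f) → first f }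

  ∣𝒟⟨321⟩∣ : ∣𝒟 N , k ⟨ 3 ∷ 2 ∷ 1 ∷ [] ⟩∣ ≡ LE (P³²¹-poset m s k)
  ∣𝒟⟨321⟩∣ = count-cong (𝒟Avoiding? N k (3 ∷ 2 ∷ 1 ∷ []))
    (isLinearExtension? (IsDecStrictPartialOrder._<?_ (P³²¹-poset m s k)))
    ((λ π∈ → Scheduled⇒LinearExtension (𝒟Avoiding⇒ π∈)) , (λ le → ⇒𝒟Avoiding (LinearExtension⇒Scheduled le)))

-- Binomial identities

[k+1]*[n+1]C[k+1]≡[n+1]*nCk : ∀ n k → suc k * (suc n C suc k) ≡ suc n * (n C k)
[k+1]*[n+1]C[k+1]≡[n+1]*nCk zero zero = refl
[k+1]*[n+1]C[k+1]≡[n+1]*nCk zero (suc k)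
  rewrite k>n⇒nCk≡0 {1} {suc (suc k)} (s≤s z<s) | k>n⇒nCk≡0 {0} {suc k} z<s = *-zeroʳ k
[k+1]*[n+1]C[k+1]≡[n+1]*nCk (suc n) zero = begin
  1 * (suc (suc n) C 1)              ≡⟨ cong (1 *_) (nCk+nC[k+1]≡[n+1]C[k+1] (suc n) 0) ⟨
  1 * (1 + suc n C 1)                ≡⟨ cong (λ c → 1 * (1 + c)) (sym (*-identityˡ (suc n C 1))) ⟩
  1 * (1 + 1 * (suc n C 1))          ≡⟨ cong (λ c → 1 * (1 + c)) ([k+1]*[n+1]C[k+1]≡[n+1]*nCk n 0) ⟩
  1 * (1 + suc n * 1)                ≡⟨ *-identityˡ (1 + suc n * 1) ⟩
  suc (suc n) * 1                    ∎
  where open ≡-Reasoning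
[k+1]*[n+1]C[k+1]≡[n+1]*nCk (suc n) (suc k) = begin
  suc (suc k) * (suc (suc n) C suc (suc k))        ≡⟨ cong (suc (suc k) *_) (nCk+nC[k+1]≡[n+1]C[k+1] (suc n) (suc k)) ⟨
  suc (suc k) * (A + suc n C suc (suc k))          ≡⟨ *-distribˡ-+ (suc (suc k)) A (suc n C suc (suc k)) ⟩
  A + suc k * A + suc (suc k) * (suc n C suc (suc k))
    ≡⟨ cong₂ (λ x y → A + x + y) ([k+1]*[n+1]C[k+1]≡[n+1]*nCk n k) ([k+1]*[n+1]C[k+1]≡[n+1]*nCk n (suc k)) ⟩
  A + suc n * (n C k) + suc n * (n C suc k)        ≡⟨ +-assoc A (suc n * (n C k)) (suc n * (n C suc k)) ⟩
  A + (suc n * (n C k) + suc n * (n C suc k))      ≡⟨ cong (A +_) (*-distribˡ-+ (suc n) (n C k) (n C suc k)) ⟨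
  A + suc n * (n C k + n C suc k)                  ≡⟨ cong (λ c → A + suc n * c) (nCk+nC[k+1]≡[n+1]C[k+1] n k) ⟩
  suc (suc n) * A                                  ∎
  where
  open ≡-Reasoning
  A = suc n C suc k

-- Subtract one Pascal term from the absorption identity. Writing the upper index as `k + d` keeps
-- truncated subtraction away.
d*[k+d]Ck≡[k+1]*[k+d]C[k+1] : ∀ k d → d * ((k + d) C k) ≡ suc k * ((k + d) C suc k)
d*[k+d]Ck≡[k+1]*[k+d]C[k+1] k d = +-cancelˡ-≡ (suc k * A) _ _ (begin
  suc k * A + d * A                 ≡⟨ *-distribʳ-+ A (suc k) d ⟨
  (suc k + d) * A                   ≡⟨ [k+1]*[n+1]C[k+1]≡[n+1]*nCk (k + d) k ⟨
  suc k * (suc (k + d) C suc k)     ≡⟨ cong (suc k *_) (nCk+nC[k+1]≡[n+1]C[k+1] (k + d) k) ⟨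
  suc k * (A + (k + d) C suc k)     ≡⟨ *-distribˡ-+ (suc k) A _ ⟩
  suc k * A + suc k * ((k + d) C suc k) ∎)
  where
  open ≡-Reasoning
  A = (k + d) C k

-- Rothe's numbers x/(x+nk) · C(x+nk, n)
rothe : (k n x : ℕ) → ℕ
rothe k zero    x       = 1
rothe k (suc n) zero    = 0
rothe k (suc n) (suc x) = rothe k (suc n) x + rothe k n (k + x)

-- The closed formula freed of division: with M + 1 = x + (n + 1)k, absorption turns x/(M + 1) · C(M
-- + 1, n + 1) into C(M + 1, n + 1) - k C(M, n). In this form Pascal's rule carries an induction on
-- `n` and, inside it, on `x`.
rothe-binomial : ∀ c n x → let k = suc c; M = x + (c + n * k) in
                 rothe k (suc n) x + k * (M C n) ≡ suc M C suc n
rothe-binomial c n zero = *-cancelˡ-≡ _ _ (suc n) (begin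
  suc n * (k * (M C n))     ≡⟨ *-assoc (suc n) k (M C n) ⟨
  suc M * (M C n)           ≡⟨ [k+1]*[n+1]C[k+1]≡[n+1]*nCk M n ⟨
  suc n * (suc M C suc n)   ∎)
  where
  open ≡-Reasoning
  k = suc c
  M = c + n * k
rothe-binomial c n (suc x) = begin
  A + rothe k n (k + x) + k * (suc M C n)   ≡⟨ +-assoc A _ _ ⟩
  A + (rothe k n (k + x) + k * (suc M C n)) ≡⟨ cong (A +_) (shift n) ⟩
  A + (suc M C n + k * (M C n))             ≡⟨ swap A (suc M C n) (k * (M C n)) ⟩
  suc M C n + (A + k * (M C n))             ≡⟨ cong (suc M C n +_) (rothe-binomial c n x) ⟩
  suc M C n + suc M C suc n                 ≡⟨ nCk+nC[k+1]≡[n+1]C[k+1] (suc M) n ⟩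
  suc (suc M) C suc n                       ∎
  where
  open ≡-Reasoning
  k = suc c
  A = rothe k (suc n) x
  M = x + (c + n * k)
  swap : ∀ a b d → a + (b + d) ≡ b + (a + d)
  swap = solve-∀
  M-shift : ∀ x c n → suc c + x + (c + n * suc c) ≡ x + (c + suc n * suc c)
  M-shift = solve-∀
  -- The same identity for a smaller first index: `x` gains k as `n` drops by one, so both instances
  -- share their upper binomial index.
  shift : ∀ n → let M = x + (c + n * k) in
          rothe k n (k + x) + k * (suc M C n) ≡ suc M C n + k * (M C n)
  shift zero    = refl
  shift (suc n) = begin
    B + k * (suc M′ C suc n)                  ≡⟨ cong (λ a → B + k * a) (nCk+nC[k+1]≡[n+1]C[k+1] M′ n) ⟨
    B + k * (M′ C n + M′ C suc n)              ≡⟨ cong (B +_) (*-distribˡ-+ k (M′ C n) (M′ C suc n)) ⟩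
    B + (k * (M′ C n) + k * (M′ C suc n))      ≡⟨ +-assoc B _ _ ⟨
    B + k * (M′ C n) + k * (M′ C suc n)
      ≡⟨ cong (_+ k * (M′ C suc n)) (subst (λ M → B + k * (M C n) ≡ suc M C suc n) (M-shift x c n) (rothe-binomial c n (k + x))) ⟩
    suc M′ C suc n + k * (M′ C suc n)          ∎
    where
    M′ = x + (c + suc n * k)
    B = rothe k (suc n) (k + x)

rothe-closed : ∀ k n x .{{_ : NonZero k}} → (x + n * k) * rothe k n x ≡ x * ((x + n * k) C n)
rothe-closed k zero    x = cong (_* 1) (+-identityʳ x)
rothe-closed k@(suc c) (suc n) x = subst (λ K → K * R ≡ x * (K C suc n)) (sym K≡)
  (+-cancelʳ-≡ (suc M * (k * (M C n))) _ _ (begin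
    suc M * R + suc M * (k * (M C n))     ≡⟨ *-distribˡ-+ (suc M) R _ ⟨
    suc M * (R + k * (M C n))             ≡⟨ cong (suc M *_) (rothe-binomial c n x) ⟩
    suc M * B                             ≡⟨ cong (_* B) (sym K≡) ⟩
    (x + suc n * k) * B                   ≡⟨ *-distribʳ-+ B x (suc n * k) ⟩
    x * B + suc n * k * B                 ≡⟨ cong (λ y → x * B + y * B) (*-comm (suc n) k) ⟩
    x * B + k * suc n * B                 ≡⟨ cong (x * B +_) (*-assoc k (suc n) B) ⟩
    x * B + k * (suc n * B)               ≡⟨ cong (λ y → x * B + k * y) ([k+1]*[n+1]C[k+1]≡[n+1]*nCk M n) ⟩
    x * B + k * (suc M * (M C n))         ≡⟨ cong (x * B +_) (x∙yz≈y∙xz k (suc M) (M C n)) ⟩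
    x * B + suc M * (k * (M C n))         ∎))
  where
  open ≡-Reasoning
  open CommutativeSemigroup *-commutativeSemigroup using (x∙yz≈y∙xz)
  R = rothe k (suc n) x
  M = x + (c + n * k)
  B = suc M C suc n
  K≡ : x + suc n * k ≡ suc M
  K≡ = +-suc x (c + n * k)

rothe-ballot : ∀ k m s .{{_ : NonZero k}} → rothe k m s * (m * k + s) ≡ s * ((m * k + s) C m)
rothe-ballot k m s = subst (λ K → rothe k m s * K ≡ s * (K C m)) (+-comm s (m * k))
  (trans (*-comm (rothe k m s) _) (rothe-closed k m s))

-- At x = k the factor k cancels in `rothe-closed`, leaving (m + 1) R = C(K, m) for K = k(m + 1).
-- Since K = m + D, passing to C(K, m + 1) trades the factor m + 1 for D.
rothe-Fuss-Catalan : ∀ k m .{{_ : NonZero k}} →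
                     rothe k m k * (1 + (k ∸ 1) * (m + 1)) ≡ 1 * ((k * (m + 1)) C (m + 1))
rothe-Fuss-Catalan k@(suc c) m = begin
  R * D                                ≡⟨ *-cancelˡ-≡ _ _ (suc m) scaled ⟩
  K C suc m                            ≡⟨ cong₂ _C_ K≡ (sym (+-comm m 1)) ⟩
  (k * (m + 1)) C (m + 1)              ≡⟨ *-identityˡ _ ⟨
  1 * ((k * (m + 1)) C (m + 1))        ∎
  where
  open ≡-Reasoning
  R = rothe k m k
  D = 1 + c * (m + 1)
  K = m + D
  K≡ : K ≡ k * (m + 1)
  K≡ = lemma c m where
    lemma : ∀ c m → m + (1 + c * (m + 1)) ≡ suc c * (m + 1)
    lemma = solve-∀
  K≡′ : k + m * k ≡ K
  K≡′ = lemma c m where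
    lemma : ∀ c m → suc c + m * suc c ≡ m + (1 + c * (m + 1))
    lemma = solve-∀
  R≡ : suc m * R ≡ K C m
  R≡ = *-cancelˡ-≡ _ _ k (begin
    k * (suc m * R)          ≡⟨ *-assoc k (suc m) R ⟨
    k * suc m * R            ≡⟨ cong (_* R) (*-comm k (suc m)) ⟩
    (k + m * k) * R          ≡⟨ rothe-closed k m k ⟩
    k * ((k + m * k) C m)    ≡⟨ cong (λ K → k * (K C m)) K≡′ ⟩
    k * (K C m)              ∎)
  scaled : suc m * (R * D) ≡ suc m * (K C suc m)
  scaled = begin
    suc m * (R * D)          ≡⟨ *-assoc (suc m) R D ⟨
    suc m * R * D            ≡⟨ cong (_* D) R≡ ⟩
    (K C m) * D              ≡⟨ *-comm (K C m) D ⟩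
    D * (K C m)              ≡⟨ d*[k+d]Ck≡[k+1]*[k+d]C[k+1] m D ⟩
    suc m * (K C suc m)      ∎

-- One-letter extensions

≮ᵇ⇒≥ : ∀ b a → T (not (b <ᵇ a)) → a ≤ b
≮ᵇ⇒≥ b       zero    _ = z≤n
≮ᵇ⇒≥ (suc b) (suc a) t = s≤s (≮ᵇ⇒≥ b a t)

≥⇒≮ᵇ : ∀ b a → a ≤ b → T (not (b <ᵇ a))
≥⇒≮ᵇ b       zero    _         = _
≥⇒≮ᵇ (suc b) (suc a) (s≤s a≤b) = ≥⇒≮ᵇ b a a≤b

module _ {L : ℕ} (a : Fin (suc L)) (b : Fin L) where

  private
    y : Fin (suc L)
    y = punchIn a b

  punchIn-below : toℕ b < toℕ a → toℕ y ≡ toℕ b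
  punchIn-below b<a with toℕ (punchIn a b) | toℕ-punchIn a b
  ... | _ | below _   = refl
  ... | _ | above a≤b = contradiction b<a (≤⇒≯ a≤b)

  punchIn-above : toℕ a ≤ toℕ b → toℕ y ≡ suc (toℕ b)
  punchIn-above a≤b with toℕ (punchIn a b) | toℕ-punchIn a b
  ... | _ | below b<a = contradiction b<a (≤⇒≯ a≤b)
  ... | _ | above _   = refl

  descent⁻ : y Fin.< a → toℕ b < toℕ a
  descent⁻ y<a with toℕ (punchIn a b) | toℕ-punchIn a b
  ... | _ | below b<a = b<a
  ... | _ | above a≤b = contradiction a≤b (<⇒≱ (<-trans (n<1+n _) y<a))

  descent⁺ : toℕ b < toℕ a → y Fin.< a
  descent⁺ b<a = subst (_< toℕ a) (sym (punchIn-below b<a)) b<a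

  ascent⁻ : a Fin.< y → toℕ a ≤ toℕ b
  ascent⁻ a<y = ≮⇒≥ (<-asym a<y ∘ descent⁺)

  ascent⁺ : toℕ a ≤ toℕ b → a Fin.< y
  ascent⁺ a≤b = subst (toℕ a <_) (sym (punchIn-above a≤b)) (s≤s a≤b)

  above-letters : toℕ a < L → toℕ y < L →
                  fromℕ L ≢ a × fromℕ L ≢ y × a Fin.< fromℕ L × y Fin.< fromℕ L
  above-letters a<L y<L =
    <⇒≢ a<L′ ∘ cong toℕ ∘ sym , <⇒≢ y<L′ ∘ cong toℕ ∘ sym , a<L′ , y<L′
    where
    a<L′ = subst (toℕ a <_) (sym (Fin.toℕ-fromℕ L)) a<L
    y<L′ = subst (toℕ y <_) (sym (Fin.toℕ-fromℕ L)) y<L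

-- The old first letter `b` becomes b + 1 if a ≤ b and stays `b` if b < a, whence the tests for
-- ascent and descent. In the direction of the pattern's first two letters there must moreover be no
-- room for a third: nothing above `y` (123), strictly between (132, 312), above `a` (213) or below
-- `a` (231).
step123 step132 step213 step231 step312 : Step
step123 true  L a b = b <ᵇ a
step123 false L a b = (suc b ≡ᵇ L) ∧ not (b <ᵇ a)
step132 true  L a b = b <ᵇ a
step132 false L a b = a ≡ᵇ b
step213 true  L a b = a ≡ᵇ L
step213 false L a b = not (b <ᵇ a)
step231 true  L a b = b <ᵇ a
step231 false L a b = a ≡ᵇ 0
step312 true  L a b = suc b ≡ᵇ a
step312 false L a b = not (b <ᵇ a)

correct123 : Correct 0F 1F 2F step123
correct123 true  a b =
  (λ (y<a , _) → <⇒<ᵇ (descent⁻ a b y<a)) ,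
  (λ t → let y<a = descent⁺ a b (<ᵇ⇒< _ _ t) in y<a , λ _ _ _ (a<y , _) → <-asym a<y y<a)
correct123 false {L} a b = to , from
  where
  to : Extends 0F 1F 2F false a b → T ((suc (toℕ b) ≡ᵇ L) ∧ not (toℕ b <ᵇ toℕ a))
  to (a<y , avoids) with m≤n⇒m<n∨m≡n (Fin.toℕ<n b)
  ... | inj₂ eq = Equivalence.from T-∧ (≡⇒≡ᵇ _ _ eq , ≥⇒≮ᵇ _ _ (ascent⁻ a b a<y))
  ... | inj₁ lt =
    let y<L = subst (_< L) (sym (punchIn-above a b (ascent⁻ a b a<y))) lt
        z≢a , z≢y , _ , y<z = above-letters a b (<-trans a<y y<L) y<L
    in  contradiction (a<y , y<z) (avoids (fromℕ L) z≢a z≢y)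
  from : T ((suc (toℕ b) ≡ᵇ L) ∧ not (toℕ b <ᵇ toℕ a)) → Extends 0F 1F 2F false a b
  from t = let t₁ , t₂ = Equivalence.to T-∧ t
               a≤b = ≮ᵇ⇒≥ _ _ t₂
           in  ascent⁺ a b a≤b , λ z _ _ (_ , y<z) →
               <-irrefl (trans (punchIn-above a b a≤b) (≡ᵇ⇒≡ _ _ t₁)) (<-≤-trans y<z (Fin.toℕ≤pred[n] z))

correct132 : Correct 0F 2F 1F step132
correct132 true a b =
  (λ (y<a , _) → <⇒<ᵇ (descent⁻ a b y<a)) ,
  (λ t → let y<a = descent⁺ a b (<ᵇ⇒< _ _ t) in y<a , λ _ _ _ (a<z , z<y) → <-asym (<-trans a<z z<y) y<a)
correct132 false a b = to , from
  where
  to : Extends 0F 2F 1F false a b → T (toℕ a ≡ᵇ toℕ b)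
  to (a<y , avoids) with m≤n⇒m<n∨m≡n (ascent⁻ a b a<y)
  ... | inj₂ eq  = ≡⇒≡ᵇ _ _ eq
  -- The unraised value of `b` is a letter strictly between `a` and y = b + 1.
  ... | inj₁ a<b = contradiction
    (subst (toℕ a <_) (sym z≡) a<b , subst₂ _<_ (sym z≡) (sym y≡) (n<1+n _))
    (avoids (inject₁ b) (λ eq → <⇒≢ a<b (trans (cong toℕ (sym eq)) z≡))
                        (λ eq → 1+n≢n (trans (sym y≡) (trans (cong toℕ (sym eq)) z≡))))
    where
    z≡ = Fin.toℕ-inject₁ b
    y≡ = punchIn-above a b (<⇒≤ a<b)
  from : T (toℕ a ≡ᵇ toℕ b) → Extends 0F 2F 1F false a b
  from t = let a≡b = ≡ᵇ⇒≡ _ _ t ; a≤b = ≤-reflexive a≡b in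
    ascent⁺ a b a≤b , λ z _ _ (a<z , z<y) →
    <⇒≱ a<z (subst (toℕ z ≤_) (sym a≡b) (s≤s⁻¹ (subst (toℕ z <_) (punchIn-above a b a≤b) z<y)))

correct213 : Correct 1F 0F 2F step213
correct213 false a b =
  (λ (a<y , _) → ≥⇒≮ᵇ _ _ (ascent⁻ a b a<y)) ,
  (λ t → let a<y = ascent⁺ a b (≮ᵇ⇒≥ _ _ t) in a<y , λ _ _ _ (y<a , _) → <-asym a<y y<a)
correct213 true {L} a b = to , from
  where
  to : Extends 1F 0F 2F true a b → T (toℕ a ≡ᵇ L)
  to (y<a , avoids) with m≤n⇒m<n∨m≡n (Fin.toℕ≤pred[n] a)
  ... | inj₂ eq  = ≡⇒≡ᵇ _ _ eq
  ... | inj₁ a<L = let z≢a , z≢y , a<z , _ = above-letters a b a<L (<-trans y<a a<L)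
                   in  contradiction (y<a , a<z) (avoids (fromℕ L) z≢a z≢y)
  from : T (toℕ a ≡ᵇ L) → Extends 1F 0F 2F true a b
  from t = let a≡L = ≡ᵇ⇒≡ _ _ t in
    descent⁺ a b (subst (toℕ b <_) (sym a≡L) (Fin.toℕ<n b)) ,
    λ z _ _ (_ , a<z) → <-irrefl a≡L (<-≤-trans a<z (Fin.toℕ≤pred[n] z))

correct231 : Correct 2F 0F 1F step231
correct231 true a b =
  (λ (y<a , _) → <⇒<ᵇ (descent⁻ a b y<a)) ,
  (λ t → let y<a = descent⁺ a b (<ᵇ⇒< _ _ t) in y<a , λ _ _ _ (_ , a<y) → <-asym a<y y<a)
correct231 false zero    b = (λ _ → _) , λ _ → z<s , λ _ _ _ ()
correct231 false (suc a) b =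
  (λ (a<y , avoids) → avoids zero (λ ()) (λ eq → <⇒≱ a<y (subst (λ y → toℕ y ≤ _) eq z≤n)) (z<s , a<y)) , λ ()

correct312 : Correct 1F 2F 0F step312
correct312 false a b =
  (λ (a<y , _) → ≥⇒≮ᵇ _ _ (ascent⁻ a b a<y)) ,
  (λ t → let a<y = ascent⁺ a b (≮ᵇ⇒≥ _ _ t) in a<y , λ _ _ _ (y<z , z<a) → <-asym a<y (<-trans y<z z<a))
correct312 true a b = to , from
  where
  to : Extends 1F 2F 0F true a b → T (suc (toℕ b) ≡ᵇ toℕ a)
  to (y<a , avoids) with m≤n⇒m<n∨m≡n (descent⁻ a b y<a)
  ... | inj₂ eq  = ≡⇒≡ᵇ _ _ eq
  -- Here y = b, and b + 1 is a letter strictly between `y` and `a`.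
  ... | inj₁ b+1<a = contradiction (y<z , b+1<a)
    (avoids (suc b) (<⇒≢ b+1<a ∘ cong toℕ) (<⇒≢ y<z ∘ cong toℕ ∘ sym))
    where
    y<z : toℕ (punchIn a b) < suc (toℕ b)
    y<z = s≤s (≤-reflexive (punchIn-below a b (descent⁻ a b y<a)))
  from : T (suc (toℕ b) ≡ᵇ toℕ a) → Extends 1F 2F 0F true a b
  from t = let a≡ = sym (≡ᵇ⇒≡ (suc (toℕ b)) (toℕ a) t) ; b<a = ≤-reflexive (sym a≡) in
    descent⁺ a b b<a , λ z _ _ (y<z , z<a) →
    <⇒≱ (subst (_< toℕ z) (punchIn-below a b b<a) y<z) (s≤s⁻¹ (subst (toℕ z <_) a≡ z<a))

-- Solving the recursions

sumBelow-cong : ∀ {f g : ℕ → ℕ} n → (∀ {b} → b < n → f b ≡ g b) → sumBelow n f ≡ sumBelow n g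
sumBelow-cong n eq = sum-cong-≗ {n} λ b → eq (Fin.toℕ<n b)

sumBelow-const : ∀ n x → sumBelow n (λ _ → x) ≡ n * x
sumBelow-const zero    x = refl
sumBelow-const (suc n) x = cong (_+_ x) (sumBelow-const n x)

sumBelow-0 : ∀ n → sumBelow n (λ _ → 0) ≡ 0
sumBelow-0 n = trans (sumBelow-const n 0) (*-zeroʳ n)

sumBelow-if : ∀ {f : ℕ → ℕ} n c → sumBelow n (λ b → if c then f b else 0) ≡ (if c then sumBelow n f else 0)
sumBelow-if n true  = refl
sumBelow-if n false = sumBelow-0 n

sumBelow-point : ∀ {f : ℕ → ℕ} n {c} → c < n → sumBelow n (λ b → if b ≡ᵇ c then f b else 0) ≡ f c
sumBelow-point {f} (suc n) {zero}  _   = trans (cong (_+_ (f 0)) (sumBelow-0 n)) (+-identityʳ (f 0))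
sumBelow-point (suc n) {suc c} c<n = sumBelow-point n (s<s⁻¹ c<n)

-- Telescoping: `h` is a discrete antiderivative vanishing at the end, so recognising a closed form
-- for tail sums reduces to its difference equation.
sumBelow-tail : ∀ {h f : ℕ → ℕ} n a → (∀ {b} → b < n → h b ≡ f b + h (suc b)) → h n ≡ 0 → a ≤ n →
                sumBelow n (λ b → if not (b <ᵇ a) then f b else 0) ≡ h a
sumBelow-tail zero    zero    rec h≡0 _   = sym h≡0
sumBelow-tail {h} {f} (suc n) zero rec h≡0 _ =
  trans (cong (_+_ (f 0)) (sumBelow-tail {h ∘ suc} n 0 (rec ∘ s<s) h≡0 z≤n)) (sym (rec z<s))
sumBelow-tail {h} (suc n) (suc a) rec h≡0 a≤n = sumBelow-tail {h ∘ suc} n a (rec ∘ s<s) h≡0 (s≤s⁻¹ a≤n)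

sumBelow-head : ∀ {h f : ℕ → ℕ} n a → (∀ {b} → b < n → h (suc b) ≡ h b + f b) → a ≤ n →
                h 0 + sumBelow n (λ b → if b <ᵇ a then f b else 0) ≡ h a
sumBelow-head {h} n       zero    rec _ = trans (cong (_+_ (h 0)) (sumBelow-0 n)) (+-identityʳ (h 0))
sumBelow-head {h} {f} (suc n) (suc a) rec a≤n = begin
  h 0 + (f 0 + Σ)   ≡⟨ +-assoc (h 0) (f 0) Σ ⟨
  h 0 + f 0 + Σ     ≡⟨ cong (_+ Σ) (rec z<s) ⟨
  h 1 + Σ           ≡⟨ sumBelow-head {h ∘ suc} n a (rec ∘ s<s) (s≤s⁻¹ a≤n) ⟩
  h (suc a)         ∎
  where
  open ≡-Reasoning
  Σ = sumBelow n (λ b → if b <ᵇ a then f (suc b) else 0)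

<ᵇ≡≮ᵇ : ∀ a b → (a <ᵇ b) ≡ not (b <ᵇ suc a)
<ᵇ≡≮ᵇ a       zero    = refl
<ᵇ≡≮ᵇ zero    (suc b) = refl
<ᵇ≡≮ᵇ (suc a) (suc b) = <ᵇ≡≮ᵇ a b

if-* : ∀ c x y → (if c then x else 0) * y ≡ x * (if c then y else 0)
if-* true  x y = refl
if-* false x y = sym (*-zeroʳ x)

∏-last : ∀ m f → ∏[0≤j< suc m ] f ≡ ∏[0≤j< m ] f * f m
∏-last m f = begin
  ∏[0≤j< suc m ] f                             ≡⟨ cong (product ∘ List.map f) (List.upTo-∷ʳ m) ⟨
  product (List.map f (upTo m List.∷ʳ m))      ≡⟨ cong product (List.map-++ f (upTo m) (m List.∷ List.[])) ⟩
  product (List.map f (upTo m) List.++ f m List.∷ List.[]) ≡⟨ product-++ (List.map f (upTo m)) _ ⟩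
  ∏[0≤j< m ] f * (f m * 1)                     ≡⟨ cong (_*_ (∏[0≤j< m ] f)) (*-identityʳ (f m)) ⟩
  ∏[0≤j< m ] f * f m                           ∎
  where
  open ≡-Reasoning

∏-unique : ∀ (t f : ℕ → ℕ) m → t 0 ≡ 1 → (∀ {r} → r < m → t (suc r) ≡ t r * f r) → t m ≡ ∏[0≤j< m ] f
∏-unique t f zero    t₀ _   = t₀
∏-unique t f (suc m) t₀ rec = begin
  t (suc m)               ≡⟨ rec (n<1+n m) ⟩
  t m * f m               ≡⟨ cong (_* f m) (∏-unique t f m t₀ (rec ∘ m<n⇒m<1+n)) ⟩
  ∏[0≤j< m ] f * f m      ≡⟨ ∏-last m f ⟨
  ∏[0≤j< suc m ] f        ∎
  where open ≡-Reasoning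

∏-cong : ∀ {f g : ℕ → ℕ} m → (∀ r → f r ≡ g r) → ∏[0≤j< m ] f ≡ ∏[0≤j< m ] g
∏-cong m f≗g = cong product (List.map-cong f≗g (upTo m))

-- shifted k′ n x a = rothe (k′ + 1) (n - a) (x + k′ a), and 0 for a > n
shifted : (k′ n x a : ℕ) → ℕ
shifted k′ n       x zero    = rothe (suc k′) n x
shifted k′ zero    x (suc a) = 0
shifted k′ (suc n) x (suc a) = shifted k′ n (x + k′) a

-- This is the difference equation that makes `shifted` at `suc x` the tail sum of `shifted` at `x`:
-- each ascent raises `x` by one.
shifted-rec : ∀ k′ n x a → shifted k′ n (suc x) a ≡ shifted k′ n x a + shifted k′ n (suc x) (suc a)
shifted-rec k′ zero    x zero    = refl
shifted-rec k′ zero    x (suc a) = refl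
shifted-rec k′ (suc n) x zero    = cong (λ y → rothe (suc k′) (suc n) x + rothe (suc k′) n (suc y)) (+-comm k′ x)
shifted-rec k′ (suc n) x (suc a) = shifted-rec k′ n (x + k′) a

shifted-vanishes : ∀ k′ {n a} x → n < a → shifted k′ n x a ≡ 0
shifted-vanishes k′ {zero}  {suc a} x _   = refl
shifted-vanishes k′ {suc n} {suc a} x n<a = shifted-vanishes k′ (x + k′) (s<s⁻¹ n<a)

-- The increasing word starts with the smallest letter whatever its length. This is why `s`
-- disappears from the 312 count.
shifted-0 : ∀ k′ x y a → shifted k′ 0 x a ≡ shifted k′ 0 y a
shifted-0 k′ x y zero    = refl
shifted-0 k′ x y (suc a) = refl

shifted-diagonal : ∀ n a → shifted 0 n 0 a ≡ (if a ≡ᵇ n then 1 else 0)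
shifted-diagonal zero    zero    = refl
shifted-diagonal (suc n) zero    = refl
shifted-diagonal zero    (suc a) = refl
shifted-diagonal (suc n) (suc a) = shifted-diagonal n a

rothe-1 : ∀ n x → rothe 1 (suc n) (suc x) ≡ (x + suc n) C x
rothe-1 n x = +-cancelʳ-≡ (M C n) _ _ (begin
  rothe 1 (suc n) (suc x) + M C n        ≡⟨ cong (_+_ (rothe 1 (suc n) (suc x))) (*-identityˡ (M C n)) ⟨
  rothe 1 (suc n) (suc x) + 1 * (M C n)  ≡⟨ rothe-binomial 0 n (suc x) ⟩
  suc M C suc n                          ≡⟨ nCk+nC[k+1]≡[n+1]C[k+1] M n ⟨
  M C n + M C suc n                      ≡⟨ +-comm (M C n) (M C suc n) ⟩
  M C suc n + M C n                      ≡⟨ cong (_+ M C n) symmetric ⟩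
  (x + suc n) C x + M C n                ∎)
  where
  open ≡-Reasoning
  M = suc x + n * 1
  M≡ : M ≡ x + suc n
  M≡ = trans (cong (_+_ (suc x)) (*-identityʳ n)) (sym (+-suc x n))
  symmetric : M C suc n ≡ (x + suc n) C x
  symmetric = begin
    M C suc n                        ≡⟨ cong (_C suc n) M≡ ⟩
    (x + suc n) C suc n              ≡⟨ nCk≡nC[n∸k] (m≤n+m (suc n) x) ⟩
    (x + suc n) C (x + suc n ∸ suc n) ≡⟨ cong ((x + suc n) C_) (m+n∸n≡m x (suc n)) ⟩
    (x + suc n) C x                  ∎

-- len r + 1 is the length of the last r + 1 blocks.
len : (s′ k′ r : ℕ) → ℕ
len s′ k′ zero    = s′
len s′ k′ (suc r) = k′ + suc (len s′ k′ r)

len-closed : ∀ s′ k′ r → suc (len s′ k′ r) ≡ r * suc k′ + suc s′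
len-closed s′ k′ zero    = refl
len-closed s′ k′ (suc r) = begin
  suc (k′ + suc (len s′ k′ r))       ≡⟨ cong (λ l → suc (k′ + l)) (len-closed s′ k′ r) ⟩
  suc (k′ + (r * suc k′ + suc s′))   ≡⟨ +-assoc (suc k′) (r * suc k′) (suc s′) ⟨
  suc r * suc k′ + suc s′            ∎
  where open ≡-Reasoning

r≤len : ∀ s′ k′ r → r ≤ len s′ k′ r
r≤len s′ k′ zero    = z≤n
r≤len s′ k′ (suc r) = ≤-trans (s≤s (r≤len s′ k′ r)) (m≤n+m _ k′)

-- The directions met while prepending letters from the right end: s - 1 ascents, then for each
-- further block one descent and k - 1 ascents. The recursions are solved from this alone, without
-- divisibility.
record BlockSchedule (s′ k′ m : ℕ) (desc : ℕ → Bool) : Set where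
  field
    start : ∀ {j} → j < s′ → desc (suc j) ≡ false
    down  : ∀ {r} → r < m → desc (suc (len s′ k′ r)) ≡ true
    up    : ∀ {r j} → r < m → j < k′ → desc (suc (j + suc (len s′ k′ r))) ≡ false

-- Totals for the single patterns, block by block

module Counts {s′ k′ m : ℕ} {desc : ℕ → Bool} (schedule : BlockSchedule s′ k′ m desc) where

  open BlockSchedule schedule

  private
    k = suc k′
    l : ℕ → ℕ
    l = len s′ k′

  starting : (P : ℕ → Set) → P 0 → (∀ {ℓ} → desc (suc ℓ) ≡ false → P ℓ → P (suc ℓ)) → P s′
  starting P p₀ next = go s′ ≤-refl
    where
    go : ∀ j → j ≤ s′ → P j
    go zero    _   = p₀
    go (suc j) j<s = next (start j<s) (go j (<⇒≤ j<s))

  climbing : ∀ {r} → r < m → (P : ℕ → Set) → P 0 →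
             (∀ {j} → desc (suc (j + suc (l r))) ≡ false → P j → P (suc j)) → P k′
  climbing {r} r<m P p₀ next = go k′ ≤-refl
    where
    go : ∀ j → j ≤ k′ → P j
    go zero    _   = p₀
    go (suc j) j<k = next (up r<m j<k) (go j (<⇒≤ j<k))

  module Count132 where

    open Transfer desc step132

    paired : ℕ → (ℕ → ℕ) → ℕ
    paired ℓ w = sumBelow (suc ℓ) λ b → ways ℓ b * w b

    -- Adjointness: exchanging the two sums moves the step from the counts onto the weights.
    paired-suc : ∀ ℓ (w w′ : ℕ → ℕ) →
      (∀ {b} → b ≤ ℓ → sumBelow (suc (suc ℓ)) (λ a → if step132 (desc (suc ℓ)) (suc ℓ) a b then w′ a else 0) ≡ w b) →
      paired (suc ℓ) w′ ≡ paired ℓ w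
    paired-suc ℓ w w′ dual = begin
      paired (suc ℓ) w′
        ≡⟨ sumBelow-cong (suc (suc ℓ)) (λ {a} _ → *-distribʳ-sum {suc ℓ} (w′ a) (λ b → if c a (toℕ b) then ways ℓ (toℕ b) else 0)) ⟩
      sumBelow (suc (suc ℓ)) (λ a → sumBelow (suc ℓ) λ b → (if c a b then ways ℓ b else 0) * w′ a)
        ≡⟨ sumBelow-cong (suc (suc ℓ)) (λ {a} _ → sumBelow-cong (suc ℓ) λ {b} _ → if-* (c a b) (ways ℓ b) (w′ a)) ⟩
      sumBelow (suc (suc ℓ)) (λ a → sumBelow (suc ℓ) λ b → ways ℓ b * (if c a b then w′ a else 0))
        ≡⟨ ∑-comm {suc (suc ℓ)} {suc ℓ} (λ a b → ways ℓ (toℕ b) * (if c (toℕ a) (toℕ b) then w′ (toℕ a) else 0)) ⟩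
      sumBelow (suc ℓ) (λ b → sumBelow (suc (suc ℓ)) λ a → ways ℓ b * (if c a b then w′ a else 0))
        ≡⟨ sumBelow-cong (suc ℓ) (λ {b} _ → *-distribˡ-sum {suc (suc ℓ)} (ways ℓ b) (λ a → if c (toℕ a) b then w′ (toℕ a) else 0)) ⟨
      sumBelow (suc ℓ) (λ b → ways ℓ b * sumBelow (suc (suc ℓ)) λ a → if c a b then w′ a else 0)
        ≡⟨ sumBelow-cong (suc ℓ) (λ {b} b≤ℓ → cong (_*_ (ways ℓ b)) (dual (s≤s⁻¹ b≤ℓ))) ⟩
      paired ℓ w ∎
      where
      open ≡-Reasoning
      c = step132 (desc (suc ℓ)) (suc ℓ)

    paired-up : ∀ {ℓ} w → desc (suc ℓ) ≡ false → paired (suc ℓ) w ≡ paired ℓ w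
    paired-up {ℓ} w up = paired-suc ℓ w w λ {b} b≤ℓ → dual b≤ℓ
      where
      dual : ∀ {b} → b ≤ ℓ → sumBelow (suc (suc ℓ)) (λ a → if step132 (desc (suc ℓ)) (suc ℓ) a b then w a else 0) ≡ w b
      dual b≤ℓ rewrite up = sumBelow-point {w} (suc (suc ℓ)) (s≤s (m≤n⇒m≤1+n b≤ℓ))

    -- The transposed descent sums the weights of all letters above `b`, and Rothe's recursion makes
    -- this tail sum telescope. The argument of the weight is the number of letters from `b` up. The
    -- k - 1 ascents that follow leave the weight unchanged, so it already refers to the length at
    -- the end of that block.
    paired-down : ∀ {ℓ} n → desc (suc ℓ) ≡ true →
      paired (suc ℓ) (λ a → rothe k n (suc (k′ + suc ℓ) ∸ a)) ≡ paired ℓ (λ b → rothe k (suc n) (suc ℓ ∸ b))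
    paired-down {ℓ} n down = paired-suc ℓ _ w′ λ {b} b≤ℓ → dual b≤ℓ
      where
      w′ h : ℕ → ℕ
      w′ a = rothe k n (suc (k′ + suc ℓ) ∸ a)
      h a = rothe k (suc n) (suc (suc ℓ) ∸ a)

      rec : ∀ {a} → a < suc (suc ℓ) → h a ≡ w′ a + h (suc a)
      rec {a} a<2+ℓ = begin
        h a                                          ≡⟨ cong (rothe k (suc n)) (+-∸-assoc 1 (s≤s⁻¹ a<2+ℓ)) ⟩
        h (suc a) + rothe k n (k + (suc ℓ ∸ a))      ≡⟨ cong (λ x → h (suc a) + rothe k n x) (+-∸-assoc k (s≤s⁻¹ a<2+ℓ)) ⟨
        h (suc a) + w′ a                             ≡⟨ +-comm (h (suc a)) (w′ a) ⟩
        w′ a + h (suc a)                             ∎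
        where open ≡-Reasoning

      dual : ∀ {b} → b ≤ ℓ → sumBelow (suc (suc ℓ)) (λ a → if step132 (desc (suc ℓ)) (suc ℓ) a b then w′ a else 0) ≡ rothe k (suc n) (suc ℓ ∸ b)
      dual {b} b≤ℓ rewrite down = trans
        (sumBelow-cong (suc (suc ℓ)) λ {a} _ → cong (if_then w′ a else 0) (<ᵇ≡≮ᵇ b a))
        (sumBelow-tail {h} (suc (suc ℓ)) (suc b) rec (cong (rothe k (suc n)) (n∸n≡0 (suc (suc ℓ)))) (s≤s (m≤n⇒m≤1+n b≤ℓ)))

    -- `n` counts the descents still to be prepended. For n = 0 the weight is constantly 1 and the
    -- pairing is the total; pulled back to a single letter, it is the weight of letter 0.
    paired-len : ∀ r n → r + n ≡ m → paired (l r) (λ b → rothe k n (suc (l r) ∸ b)) ≡ rothe k m (suc s′)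
    paired-len zero n refl = starting (λ ℓ → paired ℓ (λ b → rothe k m (suc s′ ∸ b)) ≡ rothe k m (suc s′))
      (trans (+-identityʳ _) (+-identityʳ _))
      (λ up eq → trans (paired-up (λ b → rothe k m (suc s′ ∸ b)) up) eq)
    paired-len (suc r) n refl = trans
      (climbing r<m (λ j → paired (j + suc (l r)) w ≡ paired (suc (l r)) w) refl
        (λ up eq → trans (paired-up w up) eq))
      (trans (paired-down n (down r<m)) (paired-len r (suc n) (+-suc r n)))
      where
      w = λ b → rothe k n (suc (l (suc r)) ∸ b)
      r<m : r < suc r + n
      r<m = s≤s (m≤m+n r n)

    total≡ : total (l m) ≡ rothe k m (suc s′)
    total≡ = trans (sumBelow-cong (suc (l m)) λ {b} _ → sym (*-identityʳ (ways (l m) b)))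
                   (paired-len m 0 (+-identityʳ m))

  module Count312 where

    open Transfer desc step312

    Shifted : (ℓ n x : ℕ) → Set
    Shifted ℓ n x = ∀ {a} → a ≤ ℓ → ways ℓ a ≡ shifted k′ n x a

    tail-sum : ∀ {ℓ n x} → n ≤ ℓ → Shifted ℓ n x → ∀ {a} → a ≤ suc ℓ →
               sumBelow (suc ℓ) (λ b → if not (b <ᵇ a) then ways ℓ b else 0) ≡ shifted k′ n (suc x) a
    tail-sum {ℓ} {n} {x} n≤ℓ sh {a} = sumBelow-tail {shifted k′ n (suc x)} (suc ℓ) a
      (λ {b} b≤ℓ → trans (shifted-rec k′ n x b) (cong (_+ shifted k′ n (suc x) (suc b)) (sym (sh (s≤s⁻¹ b≤ℓ)))))
      (shifted-vanishes k′ (suc x) (s≤s n≤ℓ))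

    shifted-up : ∀ {ℓ n x} → n ≤ ℓ → desc (suc ℓ) ≡ false → Shifted ℓ n x → Shifted (suc ℓ) n (suc x)
    shifted-up n≤ℓ up sh a≤ = trans (ways-suc _ up) (tail-sum n≤ℓ sh a≤)

    -- A descent prepends exactly b + 1, so the counts move up by one letter. This matches the
    -- definition of `shifted` precisely when `x` has reached `k′`, that is, after the ascents of a
    -- full block.
    shifted-down : ∀ {ℓ n} → desc (suc ℓ) ≡ true → Shifted ℓ n k′ → Shifted (suc ℓ) (suc n) 0
    shifted-down {ℓ} down sh {zero}  a≤ = trans (ways-suc zero down) (sumBelow-0 (suc ℓ))
    shifted-down {ℓ} down sh {suc a} a≤ = trans (ways-suc (suc a) down)
      (trans (sumBelow-point {ways ℓ} (suc ℓ) a≤) (sh (s≤s⁻¹ a≤)))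

    shifted-len : ∀ r → r ≤ m → Shifted (l r) r k′
    shifted-len zero _ {a} a≤ = trans
      (starting (λ ℓ → Shifted ℓ 0 ℓ) (λ { z≤n → refl }) (shifted-up z≤n) a≤)
      (shifted-0 k′ s′ k′ a)
    shifted-len (suc r) r<m = climbing r<m (λ j → Shifted (j + suc (l r)) (suc r) j)
      (shifted-down (down r<m) (shifted-len r (<⇒≤ r<m)))
      (λ {j} → shifted-up (≤-trans (s≤s (r≤len s′ k′ r)) (m≤n+m _ j)))

    total≡ : total (l m) ≡ rothe k m k
    -- The tail sum from letter 0 is the total; as one more ascent it raises k - 1 to k.
    total≡ = tail-sum (r≤len s′ k′ m) (shifted-len m ≤-refl) z≤n

  module Count213 where

    open Transfer desc step213

    -- `X` is the number of suffixes before the latest descent, `D` their length, and `j` the number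
    -- of ascents since. For the last block, which has no descent yet, X = 1 and D = 0.
    Spread : (ℓ X D j : ℕ) → Set
    Spread ℓ X D j = ∀ {a} → a ≤ ℓ → ways ℓ a ≡ X * shifted 0 D j a

    tail-sum : ∀ {ℓ X D j} → D ≤ ℓ → Spread ℓ X D j → ∀ {a} → a ≤ suc ℓ →
               sumBelow (suc ℓ) (λ b → if not (b <ᵇ a) then ways ℓ b else 0) ≡ X * shifted 0 D (suc j) a
    tail-sum {ℓ} {X} {D} {j} D≤ℓ sp {a} = sumBelow-tail {λ b → X * shifted 0 D (suc j) b} (suc ℓ) a
      (λ {b} b≤ℓ → trans (cong (_*_ X) (shifted-rec 0 D j b)) (trans (*-distribˡ-+ X _ _)
        (cong (_+ X * shifted 0 D (suc j) (suc b)) (sym (sp (s≤s⁻¹ b≤ℓ))))))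
      (trans (cong (_*_ X) (shifted-vanishes 0 (suc j) (s≤s D≤ℓ))) (*-zeroʳ X))

    spread-up : ∀ {ℓ X D j} → D ≤ ℓ → desc (suc ℓ) ≡ false → Spread ℓ X D j → Spread (suc ℓ) X D (suc j)
    spread-up {X = X} D≤ℓ up sp a≤ = trans (ways-suc _ up) (tail-sum {X = X} D≤ℓ sp a≤)

    spread-down : ∀ {ℓ} → desc (suc ℓ) ≡ true → Spread (suc ℓ) (total ℓ) (suc ℓ) 0
    spread-down {ℓ} down {a} a≤ = trans (ways-suc a down) (trans (sumBelow-if {ways ℓ} (suc ℓ) (a ≡ᵇ suc ℓ))
      (trans (lemma (a ≡ᵇ suc ℓ)) (cong (_*_ (total ℓ)) (sym (shifted-diagonal (suc ℓ) a)))))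
      where
      lemma : ∀ c → (if c then total ℓ else 0) ≡ total ℓ * (if c then 1 else 0)
      lemma true  = sym (*-identityʳ (total ℓ))
      lemma false = sym (*-zeroʳ (total ℓ))

    -- The last letter of the new block must exceed everything to its right, so it is the largest of
    -- all; the other `k′` letters of the block are an arbitrary subset of the rest.
    total-suc : ∀ {r} → r < m → total (l (suc r)) ≡ total (l r) * ((k′ + suc (l r)) C k′)
    total-suc {r} r<m = trans
      (tail-sum {X = total (l r)} (m≤n+m (suc (l r)) k′)
        (climbing r<m (λ j → Spread (j + suc (l r)) (total (l r)) (suc (l r)) j)
          (spread-down (down r<m))
          (λ {j} → spread-up {X = total (l r)} (m≤n+m (suc (l r)) j))) z≤n)
      (cong (_*_ (total (l r))) (rothe-1 (l r) k′))

    total-start : total s′ ≡ 1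
    total-start = trans
      (tail-sum {X = 1} z≤n (starting (λ ℓ → Spread ℓ 1 0 ℓ) (λ { z≤n → refl }) (spread-up {X = 1} z≤n)) z≤n)
      refl

    total≡ : total (l m) ≡ ∏[1≤j≤ m ] (λ j → (suc s′ + j * k ∸ 1) C (k ∸ 1))
    total≡ = trans (∏-unique (total ∘ l) (λ r → (k′ + suc (l r)) C k′) m total-start total-suc)
      (∏-cong m λ r → cong (_C k′) (trans (cong (_+_ k′) (len-closed s′ k′ r)) (rearrange k′ r s′)))
      where
      rearrange : ∀ k′ r s′ → k′ + (r * suc k′ + suc s′) ≡ s′ + suc r * suc k′
      rearrange = solve-∀

  module Count231 (k′≢0 : 0 < k′) where

    open Transfer desc step231

    Concentrated : ℕ → Set
    Concentrated ℓ = ∀ {a} → a ≤ ℓ → ways ℓ a ≡ (if a ≡ᵇ 0 then total ℓ else 0)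

    ways-up : ∀ {ℓ} a → desc (suc ℓ) ≡ false → ways (suc ℓ) a ≡ (if a ≡ᵇ 0 then total ℓ else 0)
    ways-up {ℓ} a up = trans (ways-suc a up) (sumBelow-if {ways ℓ} (suc ℓ) (a ≡ᵇ 0))

    total-up : ∀ {ℓ} → desc (suc ℓ) ≡ false → total (suc ℓ) ≡ total ℓ
    total-up {ℓ} up = trans (sumBelow-cong (suc (suc ℓ)) (λ {a} _ → ways-up a up))
      (sumBelow-point {λ _ → total ℓ} (suc (suc ℓ)) z<s)

    concentrated-up : ∀ {ℓ} → desc (suc ℓ) ≡ false → Concentrated (suc ℓ)
    concentrated-up up {a} _ = trans (ways-up a up) (cong (if a ≡ᵇ 0 then_else 0) (sym (total-up up)))

    -- The suffix starts with its smallest letter, so any letter but the smallest may be prepended,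
    -- each with all `total ℓ` suffixes.
    total-down : ∀ {ℓ} → desc (suc ℓ) ≡ true → Concentrated ℓ → total (suc ℓ) ≡ suc ℓ * total ℓ
    total-down {ℓ} down conc = begin
      total (suc ℓ)                          ≡⟨ sumBelow-cong (suc (suc ℓ)) (λ a≤ → ways-down (s≤s⁻¹ a≤)) ⟩
      sumBelow (suc (suc ℓ)) h               ≡⟨ sumBelow-const (suc ℓ) (total ℓ) ⟩
      suc ℓ * total ℓ                        ∎
      where
      open ≡-Reasoning
      h : ℕ → ℕ
      h zero    = 0
      h (suc a) = total ℓ
      rec : ∀ {b} → b < suc ℓ → h (suc b) ≡ h b + ways ℓ b
      rec {zero}  b≤ = sym (conc z≤n)
      rec {suc b} b≤ = sym (trans (cong (_+_ (total ℓ)) (conc (s≤s⁻¹ b≤))) (+-identityʳ (total ℓ)))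
      ways-down : ∀ {a} → a ≤ suc ℓ → ways (suc ℓ) a ≡ h a
      ways-down {a} a≤ = trans (ways-suc a down) (sumBelow-head {h} (suc ℓ) a rec a≤)

    concentrated-len : ∀ r → r ≤ m → Concentrated (l r)
    concentrated-len zero _ = starting Concentrated (λ { z≤n → refl }) (λ up _ → concentrated-up up)
    -- A descent spreads the first letter; the last of the at least one ascents in the block forces
    -- it back to the smallest. Here k ≥ 2 enters.
    concentrated-len (suc r) r<m = go k′ refl k′≢0
      where
      go : ∀ j → j ≡ k′ → 0 < j → Concentrated (j + suc (l r))
      go (suc j) refl _ = concentrated-up (up r<m (n<1+n j))

    total-suc : ∀ {r} → r < m → total (l (suc r)) ≡ total (l r) * suc (l r)
    total-suc {r} r<m = trans
      (climbing r<m (λ j → total (j + suc (l r)) ≡ total (suc (l r))) refl (λ up eq → trans (total-up up) eq))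
      (trans (total-down (down r<m) (concentrated-len r (<⇒≤ r<m))) (*-comm (suc (l r)) (total (l r))))

    total≡ : total (l m) ≡ ∏[0≤j< m ] (λ j → suc s′ + j * k)
    total≡ = trans (∏-unique (total ∘ l) (suc ∘ l) m
        (starting (λ ℓ → total ℓ ≡ 1) refl (λ up eq → trans (total-up up) eq)) total-suc)
      (∏-cong m λ r → trans (len-closed s′ k′ r) (+-comm (r * k) (suc s′)))

module Count123 {s′ m : ℕ} {desc : ℕ → Bool} (schedule : BlockSchedule s′ 1 m desc) where

  open BlockSchedule schedule
  open Transfer desc step123

  private
    l : ℕ → ℕ
    l = len s′ 1

  if-∧ : ∀ c d {x : ℕ} → (if c ∧ d then x else 0) ≡ (if c then (if d then x else 0) else 0)
  if-∧ true  d = refl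
  if-∧ false d = refl

  -- An ascent must end in the largest letter. This fixes the second letter of the new block, makes
  -- the descent after it automatic, and leaves the first letter free among the p + 2 others.
  total-suc : ∀ {r} → r < m → total (l (suc r)) ≡ total (l r) * suc (suc (l r))
  total-suc {r} r<m = begin
    total (suc (suc p))
      ≡⟨ sumBelow-cong (suc (suc (suc p))) (λ {a} _ → ways-up a) ⟩
    sumBelow (suc (suc (suc p))) (λ a → if a <ᵇ suc (suc p) then total p else 0)
      ≡⟨ sumBelow-head {λ a → a * total p} (suc (suc (suc p))) (suc (suc p)) (λ {b} _ → +-comm (total p) (b * total p)) (n≤1+n _) ⟩
    suc (suc p) * total p
      ≡⟨ *-comm (suc (suc p)) (total p) ⟩
    total p * suc (suc p) ∎
    where
    open ≡-Reasoning
    p = l r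

    ways-down : ways (suc p) (suc p) ≡ total p
    ways-down = trans (ways-suc (suc p) (down r<m)) (sumBelow-cong (suc p) λ {b} b<1+p → cong (if_then ways p b else 0) (dec b<1+p))
      where
      dec : ∀ {b n} → b < n → (b <ᵇ n) ≡ true
      dec {zero}  z<s       = refl
      dec {suc b} (s<s b<n) = dec b<n

    ways-up : ∀ a → ways (suc (suc p)) a ≡ (if a <ᵇ suc (suc p) then total p else 0)
    ways-up a = begin
      ways (suc (suc p)) a
        ≡⟨ ways-suc a (up r<m z<s) ⟩
      sumBelow (suc (suc p)) (λ b → if (b ≡ᵇ suc p) ∧ not (b <ᵇ a) then ways (suc p) b else 0)
        ≡⟨ sumBelow-cong (suc (suc p)) (λ {b} _ → if-∧ (b ≡ᵇ suc p) (not (b <ᵇ a)) {ways (suc p) b}) ⟩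
      sumBelow (suc (suc p)) (λ b → if b ≡ᵇ suc p then (if not (b <ᵇ a) then ways (suc p) b else 0) else 0)
        ≡⟨ sumBelow-point {λ b → if not (b <ᵇ a) then ways (suc p) b else 0} (suc (suc p)) (n<1+n (suc p)) ⟩
      (if not (suc p <ᵇ a) then ways (suc p) (suc p) else 0)
        ≡⟨ cong₂ (λ d (x : ℕ) → if d then x else 0) (sym (<ᵇ≡≮ᵇ a (suc (suc p)))) ways-down ⟩
      (if a <ᵇ suc (suc p) then total p else 0) ∎

  total-start : s′ ≤ 1 → total s′ ≡ 1
  total-start z≤n       = refl
  total-start (s≤s z≤n) rewrite start {j = 0} z<s = refl

  total≡ : s′ ≤ 1 → total (l m) ≡ ∏[0≤j< m ] (λ r → suc (r * 2 + suc s′))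
  total≡ s′≤1 = trans (∏-unique (total ∘ l) (λ r → suc (suc (l r))) m (total-start s′≤1) total-suc)
    (∏-cong m λ r → cong suc (len-closed s′ 1 r))

123-unavoidable : ∀ N k .{{_ : NonTrivial k}} → 3 ≤ k → 3 ≤ N → ∀ π → ¬ 𝒟Avoiding N k (1 ∷ 2 ∷ 3 ∷ []) π
123-unavoidable N@(suc (suc (suc _))) k 3≤k _ π π∈ =
  let _ , scheduled , avoids = P123.Schedule.𝒟Avoiding⇒ N k {{nonTrivial⇒nonZero k}} π∈
  in  avoids 0F 1F 2F refl (n<1+n 1)
        ( proj₂ (scheduled 0F 1F refl) (>⇒∤ (<-trans (n<1+n 1) 3≤k))
        , proj₂ (scheduled 1F 2F refl) (>⇒∤ 3≤k) )
123-unavoidable 1 k _ (s≤s ())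
123-unavoidable 2 k _ (s≤s (s≤s ()))

∣𝒟⟨123⟩∣≡0 : ∀ N k .{{_ : NonTrivial k}} → 3 ≤ k → 3 ≤ N → ∣𝒟 N , k ⟨ 1 ∷ 2 ∷ 3 ∷ [] ⟩∣ ≡ 0
∣𝒟⟨123⟩∣≡0 N k 3≤k 3≤N = count-∅ (𝒟Avoiding? N k (1 ∷ 2 ∷ 3 ∷ [])) (123-unavoidable N k 3≤k 3≤N)

-- From divisibility to blocks, and the individual counts

block-schedule : ∀ s′ k′ m {N} → N ≡ m * suc k′ + suc s′ → s′ ≤ k′ →
                 BlockSchedule s′ k′ m (λ L → does (suc k′ ∣? (N ∸ L)))
block-schedule s′ k′ m refl s′≤k′ = record { start = start ; down = down ; up = up }
  where
  k = suc k′
  N = m * k + suc s′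

  k∤ : ∀ {i} → 0 < i → i ≤ k′ → ¬ k ∣ i
  k∤ {suc i} _ i≤k′ = >⇒∤ (s≤s i≤k′)

  start : ∀ {j} → j < s′ → does (k ∣? (N ∸ suc j)) ≡ false
  start {j} j<s′ = dec-false (k ∣? (N ∸ suc j)) λ k∣ →
    k∤ (m<n⇒0<n∸m j<s′) (≤-trans (m∸n≤m s′ j) s′≤k′)
       (∣m+n∣m⇒∣n (subst (k ∣_) (+-∸-assoc (m * k) (s≤s (<⇒≤ j<s′))) k∣) (n∣m*n m))

  entered : ∀ r → N ∸ suc (len s′ k′ r) ≡ (m ∸ r) * k
  entered r = begin
    N ∸ suc (len s′ k′ r)               ≡⟨ cong (N ∸_) (len-closed s′ k′ r) ⟩
    m * k + suc s′ ∸ (r * k + suc s′)   ≡⟨ cong₂ _∸_ (+-comm (m * k) (suc s′)) (+-comm (r * k) (suc s′)) ⟩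
    suc s′ + m * k ∸ (suc s′ + r * k)   ≡⟨ [m+n]∸[m+o]≡n∸o (suc s′) (m * k) (r * k) ⟩
    m * k ∸ r * k                       ≡⟨ *-distribʳ-∸ k m r ⟨
    (m ∸ r) * k                         ∎
    where open ≡-Reasoning

  down : ∀ {r} → r < m → does (k ∣? (N ∸ suc (len s′ k′ r))) ≡ true
  down {r} _ = dec-true (k ∣? (N ∸ suc (len s′ k′ r))) (divides (m ∸ r) (entered r))

  up : ∀ {r j} → r < m → j < k′ → does (k ∣? (N ∸ suc (j + suc (len s′ k′ r)))) ≡ false
  up {r} {j} r<m j<k′ = dec-false (k ∣? (N ∸ suc (j + suc (len s′ k′ r)))) λ k∣ →
    -- The index lies j + 1 before a multiple of k, with 0 < j + 1 < k.
    k∤ z<s j<k′ (∣m+n∣m⇒∣n (subst (k ∣_) (sym (m∸n+n≡m j<)) (n∣m*n (m ∸ r))) (subst (k ∣_) eq k∣))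
    where
    M = (m ∸ r) * k
    j< : suc j ≤ M
    j< = ≤-trans (m<n⇒m<1+n j<k′) (m≤n*m k (m ∸ r) {{>-nonZero (m<n⇒0<n∸m r<m)}})
    eq : N ∸ suc (j + suc (len s′ k′ r)) ≡ M ∸ suc j
    eq = begin
      N ∸ (suc j + suc (len s′ k′ r))     ≡⟨ cong (N ∸_) (+-comm (suc j) (suc (len s′ k′ r))) ⟩
      N ∸ (suc (len s′ k′ r) + suc j)     ≡⟨ ∸-+-assoc N (suc (len s′ k′ r)) (suc j) ⟨
      N ∸ suc (len s′ k′ r) ∸ suc j       ≡⟨ cong (_∸ suc j) (entered r) ⟩
      M ∸ suc j                           ∎
      where open ≡-Reasoning

∣𝒟⟨132⟩∣ : ∀ k m s .{{_ : NonTrivial k}} .{{_ : NonZero s}} → s ≤ k →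
          ∣𝒟 m * k + s , k ⟨ 1 ∷ 3 ∷ 2 ∷ [] ⟩∣ ≡ rothe k m s
∣𝒟⟨132⟩∣ k@(suc (suc c)) m s@(suc s′) (s≤s s′≤k′) = trans
  (P132.∣𝒟∣≡total (m * k + s) k correct132 (sym (len-closed s′ (suc c) m)))
  (Counts.Count132.total≡ (block-schedule s′ (suc c) m refl s′≤k′))

∣𝒟⟨213⟩∣ : ∀ k m s .{{_ : NonTrivial k}} .{{_ : NonZero s}} → s ≤ k →
          ∣𝒟 m * k + s , k ⟨ 2 ∷ 1 ∷ 3 ∷ [] ⟩∣ ≡ ∏[1≤j≤ m ] (λ j → (s + j * k ∸ 1) C (k ∸ 1))
∣𝒟⟨213⟩∣ k@(suc (suc c)) m s@(suc s′) (s≤s s′≤k′) = trans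
  (P213.∣𝒟∣≡total (m * k + s) k correct213 (sym (len-closed s′ (suc c) m)))
  (Counts.Count213.total≡ (block-schedule s′ (suc c) m refl s′≤k′))

∣𝒟⟨231⟩∣ : ∀ k m s .{{_ : NonTrivial k}} .{{_ : NonZero s}} → s ≤ k →
          ∣𝒟 m * k + s , k ⟨ 2 ∷ 3 ∷ 1 ∷ [] ⟩∣ ≡ ∏[0≤j< m ] (λ j → s + j * k)
∣𝒟⟨231⟩∣ k@(suc (suc c)) m s@(suc s′) (s≤s s′≤k′) = trans
  (P231.∣𝒟∣≡total (m * k + s) k correct231 (sym (len-closed s′ (suc c) m)))
  (Counts.Count231.total≡ (block-schedule s′ (suc c) m refl s′≤k′) z<s)

∣𝒟⟨312⟩∣ : ∀ k m s .{{_ : NonTrivial k}} .{{_ : NonZero s}} → s ≤ k →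
          ∣𝒟 m * k + s , k ⟨ 3 ∷ 1 ∷ 2 ∷ [] ⟩∣ ≡ rothe k m k
∣𝒟⟨312⟩∣ k@(suc (suc c)) m s@(suc s′) (s≤s s′≤k′) = trans
  (P312.∣𝒟∣≡total (m * k + s) k correct312 (sym (len-closed s′ (suc c) m)))
  (Counts.Count312.total≡ (block-schedule s′ (suc c) m refl s′≤k′))

∣𝒟₂⟨123⟩∣ : ∀ m s .{{_ : NonZero s}} → s ≤ 2 →
            ∣𝒟 2 * m + s , 2 ⟨ 1 ∷ 2 ∷ 3 ∷ [] ⟩∣ ≡ ∏[0≤j< m ] (λ r → suc (r * 2 + s))
∣𝒟₂⟨123⟩∣ m s@(suc s′) (s≤s s′≤1) = trans
  (P123.∣𝒟∣≡total (2 * m + s) 2 correct123 (trans N≡ (sym (len-closed s′ 1 m))))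
  (Count123.total≡ (block-schedule s′ 1 m N≡ s′≤1) s′≤1)
  where
  N≡ : 2 * m + s ≡ m * 2 + s
  N≡ = cong (_+ s) (*-comm 2 m)

∏-even : ∀ m → ∏[0≤j< m ] (λ r → suc (r * 2 + 1)) ≡ 2 ^ m * m !
∏-even m = sym (∏-unique (λ r → 2 ^ r * r !) (λ r → suc (r * 2 + 1)) m refl λ {r} _ → step r (2 ^ r) (r !))
  where
  step : ∀ r x y → 2 * x * (suc r * y) ≡ x * y * suc (r * 2 + 1)
  step = solve-∀

open import Data.Integer.Base as ℤ using (+_)
import Data.Integer.Properties as ℤ
open import Data.Rational.Base as ℚ using ()
import Data.Rational.Properties as ℚ
open import Data.Rational.Unnormalised.Base as ℚᵘ using (mkℚᵘ; *≡*)
import Data.Rational.Unnormalised.Properties as ℚᵘ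

-- Passing to unnormalised rationals reduces the equation to cross multiplication, so no common
-- factors have to be computed.
ratio : ∀ a b c n .{{_ : NonZero n}} {w} → w ≡ a → a * n ≡ b * c →
        (+ w) ℚ./ 1 ≡ ((+ b) ℚ./ n) ℚ.* ((+ c) ℚ./ 1)
ratio a b c (suc n) refl eq = ℚ.toℚᵘ-injective (begin
  ℚ.toℚᵘ ((+ a) ℚ./ 1)                                ≈⟨ ℚ.toℚᵘ-fromℚᵘ (mkℚᵘ (+ a) 0) ⟩
  mkℚᵘ (+ a) 0                                        ≈⟨ *≡* cross ⟩
  mkℚᵘ (+ b) n ℚᵘ.* mkℚᵘ (+ c) 0
    ≈⟨ ℚᵘ.*-cong (ℚ.toℚᵘ-fromℚᵘ (mkℚᵘ (+ b) n)) (ℚ.toℚᵘ-fromℚᵘ (mkℚᵘ (+ c) 0)) ⟨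
  ℚ.toℚᵘ ((+ b) ℚ./ suc n) ℚᵘ.* ℚ.toℚᵘ ((+ c) ℚ./ 1)  ≈⟨ ℚ.toℚᵘ-homo-* ((+ b) ℚ./ suc n) ((+ c) ℚ./ 1) ⟨
  ℚ.toℚᵘ (((+ b) ℚ./ suc n) ℚ.* ((+ c) ℚ./ 1))        ∎)
  where
  open ℚᵘ.≃-Reasoning
  cross : + a ℤ.* + (suc n * 1) ≡ + b ℤ.* + c ℤ.* + 1
  cross = trans (sym (ℤ.pos-* a (suc n * 1))) (trans (cong +_ (trans (cong (a *_) (*-identityʳ (suc n))) eq))
    (trans (ℤ.pos-* b c) (sym (ℤ.*-identityʳ (+ b ℤ.* + c)))))

theorem5p7 : (k m s : ℕ) .{{k≥2 : NonTrivial k}} .{{s≥1 : NonZero s}} → s ≤ k →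
    let N = m * k + s in
    (((3 ≤ k → 3 ≤ N → ∣𝒟 N , k ⟨ 1 ∷ 2 ∷ 3 ∷ [] ⟩∣ ≡ 0)
    × ∣𝒟 2 * m + 1 , 2 ⟨ 1 ∷ 2 ∷ 3 ∷ [] ⟩∣ ≡ 2 ^ m * m !
    × ∣𝒟 2 * m + 2 , 2 ⟨ 1 ∷ 2 ∷ 3 ∷ [] ⟩∣ ≡ ∏[1≤j≤ m ] (λ j → 2 * j + 1))
    × (+ ∣𝒟 N , k ⟨ 1 ∷ 3 ∷ 2 ∷ [] ⟩∣) ℚ./ 1 ≡ ((+ s) ℚ./ N) ℚ.* ((+ (N C m)) ℚ./ 1)
    × ∣𝒟 N , k ⟨ 2 ∷ 1 ∷ 3 ∷ [] ⟩∣ ≡ ∏[1≤j≤ m ] (λ j → (s + j * k ∸ 1) C (k ∸ 1))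
    × ∣𝒟 N , k ⟨ 2 ∷ 3 ∷ 1 ∷ [] ⟩∣ ≡ ∏[0≤j< m ] (λ j → s + j * k)
    × (+ ∣𝒟 N , k ⟨ 3 ∷ 1 ∷ 2 ∷ [] ⟩∣) ℚ./ 1
    ≡ ((+ 1) ℚ./ (1 + (k ∸ 1) * (m + 1))) ℚ.* ((+ ((k * (m + 1)) C (m + 1))) ℚ./ 1)
    × ∣𝒟 N , k ⟨ 3 ∷ 2 ∷ 1 ∷ [] ⟩∣ ≡ LE (P³²¹-poset m s k))
theorem5p7 k m s s≤k =
  ( ∣𝒟⟨123⟩∣≡0 (m * k + s) k
  , trans (∣𝒟₂⟨123⟩∣ m 1 (s≤s z≤n)) (∏-even m)
  , trans (∣𝒟₂⟨123⟩∣ m 2 ≤-refl) (∏-cong m odd) )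
  , ratio (rothe k m s) s ((m * k + s) C m) (m * k + s) (∣𝒟⟨132⟩∣ k m s s≤k) (rothe-ballot k m s {{nonTrivial⇒nonZero k}})
  , ∣𝒟⟨213⟩∣ k m s s≤k
  , ∣𝒟⟨231⟩∣ k m s s≤k
  , ratio (rothe k m k) 1 ((k * (m + 1)) C (m + 1)) (1 + (k ∸ 1) * (m + 1))
      (∣𝒟⟨312⟩∣ k m s s≤k) (rothe-Fuss-Catalan k m {{nonTrivial⇒nonZero k}})
  , ∣𝒟⟨321⟩∣ m s k {{nonTrivial⇒nonZero k}}
  where
  odd : ∀ r → suc (r * 2 + 2) ≡ 2 * suc r + 1
  odd = solve-∀
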